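{- Let $G$ be a finite simple graph. If $E(G)$ can be decomposed into cliques of odd order (that is, $E(G)$ can be partitioned into the edge sets of complete subgraphs of $G$, each having an odd number of vertices), then $G$ is total weight $(1,3)$-choosable.
   Context: For a finite simple graph $G=(V,E)$ and a vertex $i\in V$, let $E(i)$ denote the set of edges incident to $i$. A total weighting of $G$ is a mapping $\phi: V\cup E\to\mathbb{R}$; it is proper if for every edge $\{i,j\}\in E$, $\sum_{e\in E(i)}\phi(e)+\phi(i)\neq \sum_{e\in E(j)}\phi(e)+\phi(j)$. For positive integers $k,k'$, $G$ is total weight $(k,k')$-choosable if for every assignment $L$ of a set $L(v)$ of $k$ real numbers to each vertex $v\in V$ and a set $L(e)$ of $k'$ real numbers to each edge $e\in E$, there is a proper total weighting $\phi$ of $G$ with $\phi(z)\in L(z)$ for all $z\in V\cup E$. The complete subgraphs in a decomposition may have different (odd) orders. -}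

module Defs where

open import Data.Bool.Base using (Bool; false; T)
open import Data.Bool.Properties using (T?)
open import Data.Fin.Base using (Fin; _<_)
open import Data.Fin.Properties using (_≟_; _<?_)
open import Data.Fin.Subset as Subset using (Subset; _∈_)
open import Data.List.Base using (List; allFin; concatMap; filter; foldr; map; mapMaybe)
open import Data.Maybe.Base as Maybe using (Maybe)
open import Data.Nat.Base as ℕ using (ℕ)
open import Data.Nat.DivMod using (_%_)
import Data.Nat.Properties as ℕ
open import Data.Product using (∃-syntax; ∃!; Σ-syntax; _×_; _,_)
open import Data.Rational.Base as ℚ using (ℚ; 0ℚ; ½)
import Data.Rational.Properties as ℚ
open import Data.Rational.Solver using (module +-*-Solver)
open import Data.Sum.Base using (_⊎_; inj₁; inj₂)
open import Relation.Binary.PropositionalEquality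
  using (_≡_; _≢_; refl; sym; trans; cong; subst)
open import Relation.Nullary.Decidable using (Dec; dec⇒maybe; _⊎-dec_; _×-dec_)

-- The reals are Cauchy sequences of rationals, as a setoid: _≈ℝ_ is equality
-- of reals, and ≠ is read positively, as apartness _#_ (equivalent to the
-- negation of _≈ℝ_ under excluded middle).

IsCauchy : (ℕ → ℚ) → Set
IsCauchy x = ∀ ε → 0ℚ ℚ.< ε →
  ∃[ N ] (∀ m n → N ℕ.≤ m → N ℕ.≤ n → ℚ.∣ x m ℚ.- x n ∣ ℚ.< ε)

record ℝ : Set where
  constructor mkℝ
  field
    seq    : ℕ → ℚ
    cauchy : IsCauchy seq

open ℝ public

infix 4 _≈ℝ_ _#_

_≈ℝ_ : ℝ → ℝ → Set
x ≈ℝ y = ∀ ε → 0ℚ ℚ.< ε →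
  ∃[ N ] (∀ n → N ℕ.≤ n → ℚ.∣ seq x n ℚ.- seq y n ∣ ℚ.< ε)

_#_ : ℝ → ℝ → Set
x # y = Σ[ ε ∈ ℚ ] (0ℚ ℚ.< ε ×
  ∃[ N ] (∀ n → N ℕ.≤ n → ε ℚ.≤ ℚ.∣ seq x n ℚ.- seq y n ∣))

0ℝ : ℝ
0ℝ = mkℝ (λ _ → 0ℚ) (λ ε 0<ε → 0 , λ _ _ _ _ → 0<ε)

private
  0<½* : ∀ ε → 0ℚ ℚ.< ε → 0ℚ ℚ.< ½ ℚ.* ε
  0<½* ε 0<ε = subst (ℚ._< ½ ℚ.* ε) (ℚ.*-zeroʳ ½) (ℚ.*-monoʳ-<-pos ½ 0<ε)

  ½+½ : ∀ ε → ½ ℚ.* ε ℚ.+ ½ ℚ.* ε ≡ ε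
  ½+½ ε = trans (sym (ℚ.*-distribʳ-+ ε ½ ½)) (ℚ.*-identityˡ ε)

  interchange : ∀ a b c d →
    (a ℚ.+ b) ℚ.- (c ℚ.+ d) ≡ (a ℚ.- c) ℚ.+ (b ℚ.- d)
  interchange = solve 4 (λ a b c d →
    (a :+ b) :- (c :+ d) := (a :- c) :+ (b :- d)) refl
    where open +-*-Solver

  +-cauchy : ∀ x y → IsCauchy x → IsCauchy y → IsCauchy (λ n → x n ℚ.+ y n)
  +-cauchy x y cx cy ε 0<ε
    with cx (½ ℚ.* ε) (0<½* ε 0<ε) | cy (½ ℚ.* ε) (0<½* ε 0<ε)
  ... | M , p | N , q = M ℕ.⊔ N , λ m n m≥ n≥ → begin-strict
    ℚ.∣ (x m ℚ.+ y m) ℚ.- (x n ℚ.+ y n) ∣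
      ≡⟨ cong ℚ.∣_∣ (interchange (x m) (y m) (x n) (y n)) ⟩
    ℚ.∣ (x m ℚ.- x n) ℚ.+ (y m ℚ.- y n) ∣
      ≤⟨ ℚ.∣p+q∣≤∣p∣+∣q∣ (x m ℚ.- x n) (y m ℚ.- y n) ⟩
    ℚ.∣ x m ℚ.- x n ∣ ℚ.+ ℚ.∣ y m ℚ.- y n ∣
      <⟨ ℚ.+-mono-< (p m n (ℕ.m⊔n≤o⇒m≤o M N m≥) (ℕ.m⊔n≤o⇒m≤o M N n≥))
                    (q m n (ℕ.m⊔n≤o⇒n≤o M N m≥) (ℕ.m⊔n≤o⇒n≤o M N n≥)) ⟩
    ½ ℚ.* ε ℚ.+ ½ ℚ.* ε
      ≡⟨ ½+½ ε ⟩
    ε ∎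
    where open ℚ.≤-Reasoning

infixl 6 _+ℝ_

_+ℝ_ : ℝ → ℝ → ℝ
x +ℝ y = mkℝ (λ n → seq x n ℚ.+ seq y n) (+-cauchy (seq x) (seq y) (cauchy x) (cauchy y))

sumℝ : List ℝ → ℝ
sumℝ = foldr _+ℝ_ 0ℝ

-- A set of exactly k reals, listed without repetition.
record RealSet (k : ℕ) : Set where
  field
    elem     : Fin k → ℝ
    distinct : ∀ a b → a ≢ b → elem a # elem b

open RealSet public

infix 4 _∈ℝ_

_∈ℝ_ : ∀ {k} → ℝ → RealSet k → Set
x ∈ℝ S = ∃[ a ] x ≈ℝ elem S a

record SimpleGraph (n : ℕ) : Set where
  field
    adj        : Fin n → Fin n → Bool
    adj-sym    : ∀ i j → adj i j ≡ adj j i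
    adj-irrefl : ∀ i → adj i i ≡ false

open SimpleGraph public

-- The unordered pair {i , j} is represented by its increasing ordering, so
-- that each edge occurs exactly once.
record Edge {n : ℕ} (G : SimpleGraph n) : Set where
  constructor mkEdge
  field
    lo hi  : Fin n
    lo<hi  : lo < hi
    joined : T (adj G lo hi)

open Edge public

module _ {n : ℕ} (G : SimpleGraph n) where

  edge? : Fin n → Fin n → Maybe (Edge G)
  edge? i j = Maybe.map (λ (i<j , p) → mkEdge i j i<j p)
                        (dec⇒maybe (i <? j ×-dec T? (adj G i j)))

  edges : List (Edge G)
  edges = concatMap (λ i → mapMaybe (edge? i) (allFin n)) (allFin n)

  Incident : Fin n → Edge G → Set
  Incident i e = i ≡ lo e ⊎ i ≡ hi e

  incident? : ∀ i e → Dec (Incident i e)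
  incident? i e = (i ≟ lo e) ⊎-dec (i ≟ hi e)

  incidentEdges : Fin n → List (Edge G)
  incidentEdges i = filter (incident? i) edges

  TotalWeighting : Set
  TotalWeighting = Fin n ⊎ Edge G → ℝ

  vertexSum : TotalWeighting → Fin n → ℝ
  vertexSum φ i = sumℝ (map (λ e → φ (inj₂ e)) (incidentEdges i)) +ℝ φ (inj₁ i)

  Proper : TotalWeighting → Set
  Proper φ = ∀ (e : Edge G) → vertexSum φ (lo e) # vertexSum φ (hi e)

  TotalWeightChoosable : ℕ → ℕ → Set
  TotalWeightChoosable k k′ =
    ∀ (LV : Fin n → RealSet k) (LE : Edge G → RealSet k′) →
    Σ[ φ ∈ TotalWeighting ]
      (Proper φ × (∀ v → φ (inj₁ v) ∈ℝ LV v) × (∀ e → φ (inj₂ e) ∈ℝ LE e))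

  IsClique : Subset n → Set
  IsClique K = ∀ i j → i ∈ K → j ∈ K → i ≢ j → T (adj G i j)

  record OddCliqueDecomposition : Set where
    field
      size      : ℕ
      clique    : Fin size → Subset n
      isClique  : ∀ a → IsClique (clique a)
      oddOrder  : ∀ a → Subset.∣ clique a ∣ % 2 ≡ 1
      partition : ∀ (e : Edge G) →
                  ∃! _≡_ (λ a → lo e ∈ clique a × hi e ∈ clique a)

{-# OPTIONS --safe #-}
module Submission where

-- Orient the edges and let l_e be the linear part of s(hi e) − s(lo e), where s(i) is the sum
-- of the weights at i.  By the Combinatorial Nullstellensatz it suffices that the product of
-- all the l_e contains a monomial with every exponent at most 2.  For e = {x , y} in an odd
-- clique of order k choose the vertex z of that clique whose rank is the midpoint of the ranks
-- of x and y modulo k, and put m_e = w_{yz} − w_{xz}.  An edge and the choice of which of its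
-- ends is the midpoint determine e, so the product of the m_e has all exponents at most 2.
-- In the apolar inner product, ⟨∏ l_e , ∏ m_e⟩ depends only on the numbers l_e · m_f, and these
-- equal v_e · v_f for v_e = X_{hi e} − X_{lo e}.  Hence it equals ⟨∏ v_e , ∏ v_e⟩, which is
-- positive because ∏ v_e is a nonzero polynomial, and some monomial occurs in both ∏ l_e and ∏ m_e.
--
-- The Nullstellensatz is used in the form of an identity: a weighted sum of the values of
-- the product over the grid of lists is the coefficient times a product of differences of list
-- elements.  It is applied to all rational approximations at once, and apartness of a finite sum
-- of Cauchy sequences from 0 passes to one of its terms.

open import Defs
open import Data.Bool.Base using (Bool; true; false; if_then_else_; T)
open import Data.Bool.Properties using (T?; T-irrelevant)
open import Data.Empty using (⊥-elim)
open import Data.Fin.Base as Fin using (Fin; zero; suc; toℕ)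
open import Data.Fin.Patterns using (0F; 1F; 2F)
import Data.Fin.Properties as Fin
open import Data.Fin.Subset as Subset using (Subset; inside; outside) renaming (_∈_ to _∈ₛ_)
open import Data.List.Base
  using (List; []; _∷_; _++_; map; mapMaybe; concatMap; length; filter; foldr; allFin)
open import Data.List.Membership.Propositional using (_∈_; lose)
open import Data.List.Membership.Propositional.Properties
  using (∈-allFin; ∈-concatMap⁺; ∈-concatMap⁻; ∈-filter⁻; ∈-map⁺; ∈-map⁻)
open import Data.List.Properties using (filter-accept)
open import Data.List.Relation.Binary.Disjoint.Propositional using (Disjoint)
open import Data.List.Relation.Binary.Permutation.Propositional
  using (_↭_; ↭-refl; ↭-trans; prep; swap)
open import Data.List.Relation.Binary.Permutation.Propositional.Properties
  using (↭-length; filter-↭)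
open import Data.List.Relation.Unary.All as All using (All; []; _∷_)
import Data.List.Relation.Unary.All.Properties as All
open import Data.List.Relation.Unary.AllPairs as AllPairs using ([]; _∷_)
import Data.List.Relation.Unary.AllPairs.Properties as AllPairs
open import Data.List.Relation.Unary.Any as Any using (here; there)
import Data.List.Relation.Unary.Any.Properties as Any
open import Data.List.Relation.Unary.Unique.Propositional using (Unique)
import Data.List.Relation.Unary.Unique.Propositional.Properties as Unique
open import Data.Maybe.Base using (Maybe; just; nothing)
import Data.Maybe.Relation.Unary.Any as Maybe
open import Data.Nat.Base as ℕ using (ℕ; zero; suc; pred; z≤n; s≤s)
open import Data.Nat.DivMod using (_%_; _/_; m≡m%n+[m/n]*n; m%n<n; m<n⇒m%n≡m; [m+kn]%n≡m%n)
import Data.Nat.Properties as ℕ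
import Data.Nat.Solver as ℕ
open import Data.Product using (∃-syntax; Σ-syntax; _×_; _,_; proj₁; proj₂)
open import Data.Rational.Base hiding (_/_)
open import Data.Rational.Properties
open import Data.Rational.Solver using (module +-*-Solver)
open import Data.Sum.Base as Sum using (_⊎_; inj₁; inj₂)
open import Data.Vec.Base using ([]; _∷_; here; there)
open import Function.Base using (_∘_)
open import Relation.Binary.Definitions using (DecidableEquality; tri<; tri≈; tri>)
open import Relation.Binary.PropositionalEquality
open import Relation.Nullary.Decidable using (yes; no; does; ¬?; map′; _×-dec_)
open import Relation.Nullary.Negation using (¬_)

private
  variable
    A B I : Set

-- Rational arithmetic.

+-interchange : ∀ a b c d → (a + b) + (c + d) ≡ (a + c) + (b + d)
+-interchange = solve 4 (λ a b c d → (a :+ b) :+ (c :+ d) := (a :+ c) :+ (b :+ d)) refl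
  where open +-*-Solver

*-interchange : ∀ a b c d → (a * b) * (c * d) ≡ (a * c) * (b * d)
*-interchange = solve 4 (λ a b c d → (a :* b) :* (c :* d) := (a :* c) :* (b :* d)) refl
  where open +-*-Solver

*-swapˡ : ∀ a b c → a * (b * c) ≡ b * (a * c)
*-swapˡ = solve 3 (λ a b c → a :* (b :* c) := b :* (a :* c)) refl
  where open +-*-Solver

p*q≢0⇒p≢0 : ∀ p q → p * q ≢ 0ℚ → p ≢ 0ℚ
p*q≢0⇒p≢0 p q pq≢0 p≡0 = pq≢0 (trans (cong (_* q) p≡0) (*-zeroˡ q))

p*q≢0⇒q≢0 : ∀ p q → p * q ≢ 0ℚ → q ≢ 0ℚ
p*q≢0⇒q≢0 p q pq≢0 q≡0 = pq≢0 (trans (cong (p *_) q≡0) (*-zeroʳ p))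

0<p⇒p≢0 : ∀ {p} → 0ℚ < p → p ≢ 0ℚ
0<p⇒p≢0 0<p p≡0 = <⇒≢ 0<p (sym p≡0)

0<p*q : ∀ {p q} → 0ℚ < p → 0ℚ < q → 0ℚ < p * q
0<p*q {p} {q} 0<p 0<q =
  positive⁻¹ (p * q) {{pos*pos⇒pos p {{positive 0<p}} q {{positive 0<q}}}}

p≢0⇒0<p*p : ∀ p → p ≢ 0ℚ → 0ℚ < p * p
p≢0⇒0<p*p p p≢0 with <-cmp p 0ℚ
... | tri< p<0 _ _ = positive⁻¹ (p * p)
  {{neg*neg⇒pos p {{negative p<0}} p {{negative p<0}}}}
... | tri≈ _ p≡0 _ = ⊥-elim (p≢0 p≡0)
... | tri> _ _ 0<p = 0<p*q 0<p 0<p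

0≤p*p : ∀ p → 0ℚ ≤ p * p
0≤p*p p with p ≟ 0ℚ
... | yes refl = ≤-refl
... | no p≢0 = <⇒≤ (p≢0⇒0<p*p p p≢0)

-- Finite sums

∑ : List A → (A → ℚ) → ℚ
∑ []       f = 0ℚ
∑ (x ∷ xs) f = f x + ∑ xs f

∑-cong : ∀ (xs : List A) {f g} → (∀ x → f x ≡ g x) → ∑ xs f ≡ ∑ xs g
∑-cong []       f≡g = refl
∑-cong (x ∷ xs) f≡g = cong₂ _+_ (f≡g x) (∑-cong xs f≡g)

∑-zero : ∀ (xs : List A) → ∑ xs (λ _ → 0ℚ) ≡ 0ℚ
∑-zero []       = refl
∑-zero (x ∷ xs) = trans (+-identityˡ _) (∑-zero xs)

∑-+ : ∀ (xs : List A) f g → ∑ xs (λ x → f x + g x) ≡ ∑ xs f + ∑ xs g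
∑-+ []       f g = refl
∑-+ (x ∷ xs) f g =
  trans (cong ((f x + g x) +_) (∑-+ xs f g)) (+-interchange (f x) (g x) _ _)

∑-*ˡ : ∀ c (xs : List A) f → ∑ xs (λ x → c * f x) ≡ c * ∑ xs f
∑-*ˡ c []       f = sym (*-zeroʳ c)
∑-*ˡ c (x ∷ xs) f =
  trans (cong (c * f x +_) (∑-*ˡ c xs f)) (sym (*-distribˡ-+ c (f x) (∑ xs f)))

∑-*ʳ : ∀ c (xs : List A) f → ∑ xs (λ x → f x * c) ≡ ∑ xs f * c
∑-*ʳ c xs f = trans (∑-cong xs (λ x → *-comm (f x) c))
             (trans (∑-*ˡ c xs f) (*-comm c (∑ xs f)))

∑-comm : ∀ (xs : List A) (ys : List B) (f : A → B → ℚ) →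
  ∑ xs (λ x → ∑ ys (λ y → f x y)) ≡ ∑ ys (λ y → ∑ xs (λ x → f x y))
∑-comm []       ys f = sym (∑-zero ys)
∑-comm (x ∷ xs) ys f =
  trans (cong (∑ ys (f x) +_) (∑-comm xs ys f)) (sym (∑-+ ys (f x) _))

∑-*-∑ : ∀ (xs : List A) (ys : List B) f g →
  ∑ xs f * ∑ ys g ≡ ∑ xs (λ x → ∑ ys (λ y → f x * g y))
∑-*-∑ xs ys f g = trans (sym (∑-*ʳ (∑ ys g) xs f))
                        (∑-cong xs (λ x → sym (∑-*ˡ (f x) ys g)))

∑-map : ∀ (h : A → B) xs f → ∑ (map h xs) f ≡ ∑ xs (λ x → f (h x))
∑-map h []       f = refl
∑-map h (x ∷ xs) f = cong (f (h x) +_) (∑-map h xs f)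

∑-++ : ∀ (xs ys : List A) f → ∑ (xs ++ ys) f ≡ ∑ xs f + ∑ ys f
∑-++ []       ys f = sym (+-identityˡ _)
∑-++ (x ∷ xs) ys f =
  trans (cong (f x +_) (∑-++ xs ys f)) (sym (+-assoc (f x) (∑ xs f) (∑ ys f)))

∑-concatMap : ∀ (h : A → List B) xs f →
  ∑ (concatMap h xs) f ≡ ∑ xs (λ x → ∑ (h x) f)
∑-concatMap h []       f = refl
∑-concatMap h (x ∷ xs) f =
  trans (∑-++ (h x) (concatMap h xs) f) (cong (∑ (h x) f +_) (∑-concatMap h xs f))

∑≢0⇒∃≢0 : ∀ (xs : List A) f → ∑ xs f ≢ 0ℚ → ∃[ x ] (x ∈ xs × f x ≢ 0ℚ)
∑≢0⇒∃≢0 []       f ∑≢0 = ⊥-elim (∑≢0 refl)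
∑≢0⇒∃≢0 (x ∷ xs) f ∑≢0 with f x ≟ 0ℚ
... | no  fx≢0 = x , here refl , fx≢0
... | yes fx≡0 with ∑≢0⇒∃≢0 xs f (λ ∑≡0 → ∑≢0 (cong₂ _+_ fx≡0 ∑≡0))
... | y , y∈xs , fy≢0 = y , there y∈xs , fy≢0

0≤∑ : ∀ (xs : List A) f → (∀ x → 0ℚ ≤ f x) → 0ℚ ≤ ∑ xs f
0≤∑ []       f 0≤f = ≤-refl
0≤∑ (x ∷ xs) f 0≤f = +-mono-≤ (0≤f x) (0≤∑ xs f 0≤f)

0<∑ : ∀ {xs : List A} f → (∀ x → 0ℚ ≤ f x) → ∀ {x} → x ∈ xs → 0ℚ < f x → 0ℚ < ∑ xs f
0<∑ {xs = x ∷ xs} f 0≤f (here refl)  0<fx = +-mono-<-≤ 0<fx (0≤∑ xs f 0≤f)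
0<∑ {xs = x ∷ xs} f 0≤f (there y∈xs) 0<fy = +-mono-≤-< (0≤f x) (0<∑ f 0≤f y∈xs 0<fy)

-- Polarised products of linear forms and the apolar pairing.

-- The factor is chosen by position, so equal factors count separately, as in the product rule.
picks : List A → List (A × List A)
picks []       = []
picks (x ∷ xs) = (x , xs) ∷ map (λ (y , ys) → y , x ∷ ys) (picks xs)

∑-picks-∷ : ∀ (x : A) xs f →
  ∑ (picks (x ∷ xs)) f ≡ f (x , xs) + ∑ (picks xs) (λ (y , ys) → f (y , x ∷ ys))
∑-picks-∷ x xs f = cong (f (x , xs) +_) (∑-map _ (picks xs) f)

∈-picks⁻ : ∀ {xs : List A} {y ys} → (y , ys) ∈ picks xs → xs ↭ y ∷ ys
∈-picks⁻ {xs = x ∷ xs} (here refl) = ↭-refl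
∈-picks⁻ {xs = x ∷ xs} (there p∈) with ∈-map⁻ _ p∈
... | (y , ys) , q∈ , refl = ↭-trans (prep x (∈-picks⁻ q∈)) (swap x y ↭-refl)

-- A list of index type I and a family F : I → A → ℚ of linear forms encode a
-- product of linear forms in the variables A; polar as F is is its polarisation,
-- i.e. the mixed partial derivative along the word w.

polar : (I → A → ℚ) → List I → List A → ℚ
polar F is      (a ∷ w) = ∑ (picks is) (λ (i , js) → F i a * polar F js w)
polar F []      []      = 1ℚ
-- After the last derivative the value is taken at the origin, where the remaining forms vanish.
polar F (_ ∷ _) []      = 0ℚ

words : List A → ℕ → List (List A)
words as zero    = [] ∷ []
words as (suc k) = concatMap (λ a → map (a ∷_) (words as k)) as

∑-words : ∀ (as : List A) k f →
  ∑ (words as (suc k)) f ≡ ∑ as (λ a → ∑ (words as k) (λ w → f (a ∷ w)))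
∑-words as k f = trans (∑-concatMap _ as f)
                       (∑-cong as (λ a → ∑-map (a ∷_) (words as k) f))

∈-words⁻ : ∀ (as : List A) k {w} → w ∈ words as k → length w ≡ k
∈-words⁻ as zero    (here refl) = refl
∈-words⁻ as (suc k) w∈ with Any.satisfied (∈-concatMap⁻ _ {xs = as} w∈)
... | a , w∈a with ∈-map⁻ _ w∈a
... | w′ , w′∈ , refl = cong suc (∈-words⁻ as k w′∈)

⟨_⟩_∙_ : List A → (A → ℚ) → (A → ℚ) → ℚ
⟨ as ⟩ f ∙ g = ∑ as (λ a → f a * g a)

-- On products of k forms this is k! times the apolar inner product: a monomial with exponents α has
-- k!/α! words, and each of the two derivatives contributes α!.
polarProduct : List A → ℕ → (F G : I → A → ℚ) → List I → List I → ℚ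
polarProduct as k F G is js = ⟨ words as k ⟩ polar F is ∙ polar G js

-- The product rule for the first letter takes one form from either side, and summing over that
-- letter turns the two forms into their dot product.
polarProduct-suc : ∀ (as : List A) k (F G : I → A → ℚ) is js →
  polarProduct as (suc k) F G is js ≡
  ∑ (picks is) (λ (i , is′) → ∑ (picks js) (λ (j , js′) →
    (⟨ as ⟩ F i ∙ G j) * polarProduct as k F G is′ js′))
polarProduct-suc as k F G is js = begin
  polarProduct as (suc k) F G is js
    ≡⟨ ∑-words as k _ ⟩
  ∑ as (λ a → ∑ W (λ w → polar F is (a ∷ w) * polar G js (a ∷ w)))
    ≡⟨ ∑-cong as (λ a → trans (∑-cong W (λ w → expand a w)) (pull a)) ⟩
  ∑ as (λ a → ∑ (picks is) (λ (i , is′) → ∑ (picks js) (λ (j , js′) →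
    (F i a * G j a) * polarProduct as k F G is′ js′)))
    ≡⟨ ∑-comm as (picks is) _ ⟩
  ∑ (picks is) (λ (i , is′) → ∑ as (λ a → ∑ (picks js) (λ (j , js′) →
    (F i a * G j a) * polarProduct as k F G is′ js′)))
    ≡⟨ ∑-cong (picks is) (λ (i , is′) → trans (∑-comm as (picks js) _)
         (∑-cong (picks js) (λ (j , js′) → ∑-*ʳ _ as _))) ⟩
  ∑ (picks is) (λ (i , is′) → ∑ (picks js) (λ (j , js′) →
    (⟨ as ⟩ F i ∙ G j) * polarProduct as k F G is′ js′)) ∎
  where
  open ≡-Reasoning
  W = words as k
  expand : ∀ a w → polar F is (a ∷ w) * polar G js (a ∷ w) ≡
    ∑ (picks is) (λ (i , is′) → ∑ (picks js) (λ (j , js′) →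
      (F i a * G j a) * (polar F is′ w * polar G js′ w)))
  expand a w = trans (∑-*-∑ (picks is) (picks js) _ _)
    (∑-cong (picks is) (λ (i , is′) → ∑-cong (picks js) (λ (j , js′) →
      *-interchange (F i a) (polar F is′ w) (G j a) (polar G js′ w))))
  pull : ∀ a → ∑ W (λ w → ∑ (picks is) (λ (i , is′) → ∑ (picks js) (λ (j , js′) →
      (F i a * G j a) * (polar F is′ w * polar G js′ w)))) ≡
    ∑ (picks is) (λ (i , is′) → ∑ (picks js) (λ (j , js′) →
      (F i a * G j a) * polarProduct as k F G is′ js′))
  pull a = trans (∑-comm W (picks is) _) (∑-cong (picks is) (λ (i , is′) →
    trans (∑-comm W (picks js) _) (∑-cong (picks js) (λ (j , js′) →
      ∑-*ˡ (F i a * G j a) W _))))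

-- Unfolding the recursion leaves nothing but dot products of forms. The variables may therefore be
-- of different types, which lets a product in vertex variables be compared with one in edge
-- variables.
polarProduct-cong : ∀ (as : List A) (bs : List B)
  (F G : I → A → ℚ) (F′ G′ : I → B → ℚ) →
  (∀ i j → ⟨ as ⟩ F i ∙ G j ≡ ⟨ bs ⟩ F′ i ∙ G′ j) →
  ∀ k is js → polarProduct as k F G is js ≡ polarProduct bs k F′ G′ is js
polarProduct-cong as bs F G F′ G′ eq zero is js =
  cong (λ x → x + 0ℚ) (cong₂ _*_ (polar-[] is) (polar-[] js))
  where
  polar-[] : ∀ {H : _ → _ → ℚ} {H′ : _ → _ → ℚ} is → polar H is [] ≡ polar H′ is []
  polar-[] []      = refl
  polar-[] (_ ∷ _) = refl
polarProduct-cong as bs F G F′ G′ eq (suc k) is js =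
  trans (polarProduct-suc as k F G is js)
 (trans (∑-cong (picks is) (λ (i , is′) → ∑-cong (picks js) (λ (j , js′) →
          cong₂ _*_ (eq i j) (polarProduct-cong as bs F G F′ G′ eq k is′ js′))))
        (sym (polarProduct-suc bs k F′ G′ is js)))

monomial : (A → ℚ) → List A → ℚ
monomial X []      = 1ℚ
monomial X (a ∷ w) = X a * monomial X w

-- Up to the factor k! the sum is the product of the values of the forms at X.
0<∑-polar-monomial : ∀ (as : List A) (F : I → A → ℚ) X → (∀ i → 0ℚ < ⟨ as ⟩ F i ∙ X) →
  ∀ k is → length is ≡ k → 0ℚ < ⟨ words as k ⟩ polar F is ∙ monomial X
0<∑-polar-monomial as F X 0<F zero [] refl = positive⁻¹ 1ℚ
0<∑-polar-monomial as F X 0<F (suc k) (i ∷ is) eq =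
  subst (0ℚ <_) (sym (step (i ∷ is))) (0<∑-pos (picks (i ∷ is)) _ (here refl)
    (λ {(j , js)} p∈ → 0<p*q (0<F j) (0<∑-polar-monomial as F X 0<F k js
      (ℕ.suc-injective (trans (sym (↭-length (∈-picks⁻ {xs = i ∷ is} p∈))) eq)))))
  where
  W = words as k
  0<∑-pos : ∀ (xs : List A) f {x} → x ∈ xs → (∀ {y} → y ∈ xs → 0ℚ < f y) → 0ℚ < ∑ xs f
  0<∑-pos (x ∷ [])     f x∈ 0<f = subst (0ℚ <_) (sym (+-identityʳ (f x))) (0<f (here refl))
  0<∑-pos (x ∷ y ∷ xs) f x∈ 0<f =
    +-mono-< (0<f (here refl)) (0<∑-pos (y ∷ xs) f (here refl) (λ y∈ → 0<f (there y∈)))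
  open ≡-Reasoning
  step : ∀ is → ⟨ words as (suc k) ⟩ polar F is ∙ monomial X ≡
    ∑ (picks is) (λ (j , js) → (⟨ as ⟩ F j ∙ X) * (⟨ W ⟩ polar F js ∙ monomial X))
  step is = begin
    ⟨ words as (suc k) ⟩ polar F is ∙ monomial X
      ≡⟨ ∑-words as k _ ⟩
    ∑ as (λ a → ∑ W (λ w → polar F is (a ∷ w) * (X a * monomial X w)))
      ≡⟨ ∑-cong as (λ a → ∑-cong W (λ w → trans (sym (∑-*ʳ _ (picks is) _))
           (∑-cong (picks is) (λ (j , js) →
             *-interchange (F j a) (polar F js w) (X a) (monomial X w))))) ⟩
    ∑ as (λ a → ∑ W (λ w → ∑ (picks is) (λ (j , js) →
      (F j a * X a) * (polar F js w * monomial X w))))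
      ≡⟨ ∑-cong as (λ a → trans (∑-comm W (picks is) _)
           (∑-cong (picks is) (λ (j , js) → ∑-*ˡ (F j a * X a) W _))) ⟩
    ∑ as (λ a → ∑ (picks is) (λ (j , js) →
      (F j a * X a) * (⟨ W ⟩ polar F js ∙ monomial X)))
      ≡⟨ ∑-comm as (picks is) _ ⟩
    ∑ (picks is) (λ (j , js) → ∑ as (λ a →
      (F j a * X a) * (⟨ W ⟩ polar F js ∙ monomial X)))
      ≡⟨ ∑-cong (picks is) (λ (j , js) → ∑-*ʳ _ as _) ⟩
    _ ∎

-- A point `X` where all the forms are positive shows that their product is a nonzero polynomial.
-- Some derivative is then nonzero, and it enters the sum as a square.
0<polarProduct : ∀ (as : List A) (F : I → A → ℚ) X → (∀ i → 0ℚ < ⟨ as ⟩ F i ∙ X) →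
  ∀ is → 0ℚ < polarProduct as (length is) F F is is
0<polarProduct as F X 0<F is
  with ∑≢0⇒∃≢0 (words as (length is)) _
         (0<p⇒p≢0 (0<∑-polar-monomial as F X 0<F (length is) is refl))
... | w , w∈ , Tw≢0 = 0<∑ _ (λ v → 0≤p*p (polar F is v)) w∈
        (p≢0⇒0<p*p (polar F is w) (p*q≢0⇒p≢0 (polar F is w) (monomial X w) Tw≢0))

∑-single : ∀ {xs : List A} {f x} → Unique xs → x ∈ xs → (∀ y → x ≢ y → f y ≡ 0ℚ) →
  ∑ xs f ≡ f x
∑-single {f = f} {x} (x∉xs ∷ _) (here refl) f≡0 =
  trans (cong (f x +_) (off x∉xs)) (+-identityʳ (f x))
  where
  off : ∀ {xs} → All (x ≢_) xs → ∑ xs f ≡ 0ℚ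
  off []           = refl
  off (x≢y ∷ x∉xs) = cong₂ _+_ (f≡0 _ x≢y) (off x∉xs)
∑-single {f = f} {x} (y∉xs ∷ u) (there x∈xs) f≡0 =
  trans (cong₂ _+_ (f≡0 _ (λ x≡y → All.lookup y∉xs x∈xs (sym x≡y))) (∑-single u x∈xs f≡0))
        (+-identityˡ (f x))

-- Finite products, and divided differences at three points.

∏ : List A → (A → ℚ) → ℚ
∏ []       f = 1ℚ
∏ (x ∷ xs) f = f x * ∏ xs f

∏-cong : ∀ (xs : List A) {f g} → (∀ x → f x ≡ g x) → ∏ xs f ≡ ∏ xs g
∏-cong []       f≡g = refl
∏-cong (x ∷ xs) f≡g = cong₂ _*_ (f≡g x) (∏-cong xs f≡g)

-- Weights of the divided difference of order k at the three points q, cleared of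
-- denominators; only k ≤ 2 is meaningful.

weight : (Fin 3 → ℚ) → ℕ → Fin 3 → ℚ
weight q 0 0F      = 1ℚ
weight q 0 (suc _) = 0ℚ
weight q 1 0F      = - 1ℚ
weight q 1 1F      = 1ℚ
weight q 1 2F      = 0ℚ
weight q 2 0F      = q 2F - q 1F
weight q 2 1F      = q 0F - q 2F
weight q 2 2F      = q 1F - q 0F
weight q _ _       = 0ℚ

-- The last point that the divided difference of order k uses.
node : (Fin 3 → ℚ) → ℕ → ℚ
node q 0 = q 0F
node q 1 = q 1F
node q _ = q 2F

-- For k = 1 and k = 2, the ratio of the denominators cleared in orders k and k - 1. The value 0 in
-- order 0 kills the term in which `pred` fails to lower the order.
gap : (Fin 3 → ℚ) → ℕ → ℚ
gap q 1 = q 1F - q 0F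
gap q 2 = (q 2F - q 0F) * (q 2F - q 1F)
gap q _ = 0ℚ

-- The value of the cleared divided difference of order k on the k-th power.
scale : (Fin 3 → ℚ) → ℕ → ℚ
scale q zero    = 1ℚ
scale q (suc k) = gap q (suc k) * scale q k

isZero : ℕ → ℚ
isZero zero    = 1ℚ
isZero (suc _) = 0ℚ

module _ (q : Fin 3 → ℚ) where
  open +-*-Solver

  -- The Leibniz rule (x f)[q₀,...,qₖ] = qₖ f[q₀,...,qₖ] + f[q₀,...,qₖ₋₁] for divided differences,
  -- read off at each point with the denominators cleared.
  weight-shift : ∀ {k} → k ℕ.≤ 2 → ∀ i →
    weight q k i * q i ≡ node q k * weight q k i + gap q k * weight q (pred k) i
  weight-shift {0} _ 0F = solve 1 (λ a →
    con 1ℚ :* a := a :* con 1ℚ :+ con 0ℚ :* con 1ℚ) refl (q 0F)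
  weight-shift {0} _ (suc i) = solve 2 (λ a b →
    con 0ℚ :* b := a :* con 0ℚ :+ con 0ℚ :* con 0ℚ) refl (q 0F) (q (suc i))
  weight-shift {1} _ 0F = solve 2 (λ a b →
    con (- 1ℚ) :* a := b :* con (- 1ℚ) :+ (b :- a) :* con 1ℚ) refl (q 0F) (q 1F)
  weight-shift {1} _ 1F = solve 2 (λ a b →
    con 1ℚ :* b := b :* con 1ℚ :+ (b :- a) :* con 0ℚ) refl (q 0F) (q 1F)
  weight-shift {1} _ 2F = solve 3 (λ a b c →
    con 0ℚ :* c := b :* con 0ℚ :+ (b :- a) :* con 0ℚ) refl (q 0F) (q 1F) (q 2F)
  weight-shift {2} _ 0F = solve 3 (λ a b c →
    (c :- b) :* a := c :* (c :- b) :+ ((c :- a) :* (c :- b)) :* con (- 1ℚ))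
    refl (q 0F) (q 1F) (q 2F)
  weight-shift {2} _ 1F = solve 3 (λ a b c →
    (a :- c) :* b := c :* (a :- c) :+ ((c :- a) :* (c :- b)) :* con 1ℚ)
    refl (q 0F) (q 1F) (q 2F)
  weight-shift {2} _ 2F = solve 3 (λ a b c →
    (b :- a) :* c := c :* (b :- a) :+ ((c :- a) :* (c :- b)) :* con 0ℚ)
    refl (q 0F) (q 1F) (q 2F)
  weight-shift {suc (suc (suc _))} (s≤s (s≤s ())) i

-- Opaque only so that sums over the three choices are not unfolded.
opaque
  choices : List (Fin 3)
  choices = allFin 3

opaque
  unfolding choices

  -- Divided differences of positive order annihilate constants.
  ∑-weight : ∀ q k → ∑ choices (weight q k) ≡ isZero k
  ∑-weight q 0 = refl
  ∑-weight q 1 = refl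
  ∑-weight q 2 = solve 3 (λ a b c →
    (c :- b) :+ ((a :- c) :+ ((b :- a) :+ con 0ℚ)) := con 0ℚ) refl (q 0F) (q 1F) (q 2F)
    where open +-*-Solver
  ∑-weight q (suc (suc (suc k))) = refl

ifPositive : ℕ → ℚ → ℚ
ifPositive zero    x = 0ℚ
ifPositive (suc _) x = x

fromℕ : ℕ → ℚ
fromℕ zero    = 0ℚ
fromℕ (suc n) = 1ℚ + fromℕ n

-- Coefficients of a product of linear forms.

module Polynomial (_≟_ : DecidableEquality A) where

  -- Serves both to raise or lower one exponent and to overwrite one value of an assignment.
  adjust : (B → B) → A → (A → B) → A → B
  adjust f e K x = if does (e ≟ x) then f (K x) else K x

  adjust-≡ : ∀ (f : B → B) e K → adjust f e K e ≡ f (K e)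
  adjust-≡ f e K with e ≟ e
  ... | yes _  = refl
  ... | no e≢e = ⊥-elim (e≢e refl)

  adjust-≢ : ∀ (f : B → B) {e x} K → e ≢ x → adjust f e K x ≡ K x
  adjust-≢ f {e} {x} K e≢x with e ≟ x
  ... | yes e≡x = ⊥-elim (e≢x e≡x)
  ... | no _    = refl

  adjust-inverse : ∀ (f g : B → B) e K → g (f (K e)) ≡ K e →
    ∀ x → adjust g e (adjust f e K) x ≡ K x
  adjust-inverse f g e K inv x with e ≟ x
  ... | yes refl = inv
  ... | no _     = refl

  adjust-comm : ∀ (f g : B → B) {e u} K → e ≢ u →
    ∀ x → adjust g u (adjust f e K) x ≡ adjust f e (adjust g u K) x
  adjust-comm f g {e} {u} K e≢u x with e ≟ x | u ≟ x
  ... | yes refl | yes refl = ⊥-elim (e≢u refl)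
  ... | yes _    | no _     = refl
  ... | no _     | yes _    = refl
  ... | no _     | no _     = refl

  adjust-cong : ∀ (f : B → B) e {K K′} → (∀ x → K x ≡ K′ x) →
    ∀ x → adjust f e K x ≡ adjust f e K′ x
  adjust-cong f e K≡K′ x with e ≟ x
  ... | yes _ = cong f (K≡K′ x)
  ... | no _  = K≡K′ x

  multiplicity : List A → A → ℕ
  multiplicity = foldr (adjust suc) (λ _ → 0)

  degree : (A → ℕ) → List A → ℕ
  degree K []       = 0
  degree K (e ∷ es) = K e ℕ.+ degree K es

  degree-cong : ∀ {K K′ es} → All (λ e → K e ≡ K′ e) es → degree K es ≡ degree K′ es
  degree-cong []           = refl
  degree-cong (K≡K′ ∷ eqs) = cong₂ ℕ._+_ K≡K′ (degree-cong eqs)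

  degree-suc : ∀ {es e} K K′ → Unique es → e ∈ es → K e ≡ suc (K′ e) →
    (∀ x → e ≢ x → K x ≡ K′ x) → degree K es ≡ suc (degree K′ es)
  degree-suc K K′ (e∉ ∷ u) (here refl) Ke≡ K≡ = cong₂ ℕ._+_ Ke≡ (degree-cong (All.map (K≡ _) e∉))
  degree-suc K K′ (x∉ ∷ u) (there e∈) Ke≡ K≡ = trans
    (cong₂ ℕ._+_ (K≡ _ (λ e≡x → All.lookup x∉ e∈ (sym e≡x))) (degree-suc K K′ u e∈ Ke≡ K≡))
    (ℕ.+-suc _ _)

  -- The coefficient at `K` of the empty product 1.
  constantTerm : (A → ℕ) → List A → ℚ
  constantTerm K es = ∏ es (isZero ∘ K)

  constantTerm-≡0 : ∀ K {es e} → e ∈ es → isZero (K e) ≡ 0ℚ → constantTerm K es ≡ 0ℚ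
  constantTerm-≡0 K {e ∷ es} (here refl) eq =
    trans (cong (_* constantTerm K es) eq) (*-zeroˡ (constantTerm K es))
  constantTerm-≡0 K {x ∷ es} (there e∈)  eq =
    trans (cong (isZero (K x) *_) (constantTerm-≡0 K e∈ eq)) (*-zeroʳ (isZero (K x)))

  module Forms (es : List A) (unique : Unique es) (complete : ∀ e → e ∈ es)
               (F : I → A → ℚ) where

    -- The coefficient of the monomial with exponents `K`, found by expanding the first form.
    -- `ifPositive` discards variables of exponent 0, for which `pred` would leave `K` unchanged.
    coef : List I → (A → ℕ) → ℚ
    coef []       K = constantTerm K es
    coef (i ∷ is) K = ∑ es (λ e → F i e * ifPositive (K e) (coef is (adjust pred e K)))

    coef-cong : ∀ is {K K′} → (∀ x → K x ≡ K′ x) → coef is K ≡ coef is K′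
    coef-cong []       K≡K′ = ∏-cong es (λ e → cong isZero (K≡K′ e))
    coef-cong (i ∷ is) K≡K′ = ∑-cong es (λ e → cong (F i e *_)
      (cong₂ ifPositive (K≡K′ e) (coef-cong is (adjust-cong pred e K≡K′))))

    -- Both sides are the coefficient at K of the partial derivative with respect to e.
    coef-derivative : ∀ is K e → fromℕ (suc (K e)) * coef is (adjust suc e K) ≡
      ∑ (picks is) (λ (i , js) → F i e * coef js K)
    coef-derivative [] K e =
      trans (cong (fromℕ (suc (K e)) *_)
              (constantTerm-≡0 (adjust suc e K) (complete e) (cong isZero (adjust-≡ suc e K))))
            (*-zeroʳ (fromℕ (suc (K e))))
    coef-derivative (i ∷ is) K e = begin
      q * coef (i ∷ is) (adjust suc e K)
        ≡⟨ ∑-*ˡ q es _ ⟨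
      ∑ es (λ u → q * (F i u *
        ifPositive (adjust suc e K u) (coef is (adjust pred u (adjust suc e K)))))
        ≡⟨ ∑-cong es termwise ⟩
      ∑ es (λ u → head u + F i u * ifPositive (K u) (tail u))
        ≡⟨ ∑-+ es head _ ⟩
      ∑ es head + ∑ es (λ u → F i u * ifPositive (K u) (tail u))
        ≡⟨ cong₂ _+_ head-sum tail-sum ⟩
      F i e * coef is K + ∑ (picks is) (λ (j , js) → F j e * coef (i ∷ js) K)
        ≡⟨ ∑-picks-∷ i is (λ (j , js) → F j e * coef js K) ⟨
      ∑ (picks (i ∷ is)) (λ (j , js) → F j e * coef js K) ∎
      where
      open ≡-Reasoning
      q = fromℕ (suc (K e))
      -- In `head` the derivative falls on the form `i`, which happens only at `e`; in `tail` it
      -- falls on one of the other forms.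
      head : A → ℚ
      head u = if does (e ≟ u) then F i u * coef is K else 0ℚ
      tail : A → ℚ
      tail u = ∑ (picks is) (λ (j , js) → F j e * coef js (adjust pred u K))

      head-sum : ∑ es head ≡ F i e * coef is K
      head-sum = trans (∑-single unique (complete e) off) on
        where
        off : ∀ y → e ≢ y → head y ≡ 0ℚ
        off y e≢y with e ≟ y
        ... | yes e≡y = ⊥-elim (e≢y e≡y)
        ... | no _    = refl
        on : head e ≡ F i e * coef is K
        on with e ≟ e
        ... | yes _  = refl
        ... | no e≢e = ⊥-elim (e≢e refl)

      tail-sum : ∑ es (λ u → F i u * ifPositive (K u) (tail u)) ≡
        ∑ (picks is) (λ (j , js) → F j e * coef (i ∷ js) K)
      tail-sum = trans (∑-cong es (λ u →
          trans (cong (F i u *_) (push (K u) u)) (sym (∑-*ˡ (F i u) (picks is) _))))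
        (trans (∑-comm es (picks is) _) (∑-cong (picks is) (λ (j , js) →
          trans (∑-cong es (λ u → *-swapˡ (F i u) (F j e) _)) (∑-*ˡ (F j e) es _))))
        where
        push : ∀ k u → ifPositive k (tail u) ≡
          ∑ (picks is) (λ (j , js) → F j e * ifPositive k (coef js (adjust pred u K)))
        push zero    u =
          sym (trans (∑-cong (picks is) (λ (j , js) → *-zeroʳ (F j e))) (∑-zero (picks is)))
        push (suc k) u = refl

      termwise : ∀ u →
        q * (F i u * ifPositive (adjust suc e K u) (coef is (adjust pred u (adjust suc e K)))) ≡
        head u + F i u * ifPositive (K u) (tail u)
      termwise u with e ≟ u
      ... | yes refl = trans
              (cong (λ c → q * (F i e * c)) (coef-cong is (adjust-inverse suc pred e K refl)))
              (diagonal (K e) refl)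
        where
        diagonal : ∀ k → K e ≡ k → fromℕ (suc k) * (F i e * coef is K) ≡
          F i e * coef is K + F i e * ifPositive k (tail e)
        diagonal zero    eq = trans (*-identityˡ (F i e * coef is K))
          (sym (trans (cong (F i e * coef is K +_) (*-zeroʳ (F i e))) (+-identityʳ _)))
        -- The factor K e + 1 is split: the 1 yields `head`, and K e is the factor that the
        -- induction hypothesis at `adjust pred e K` requires.
        diagonal (suc k) eq = trans
          (solve 3 (λ n x y → (con 1ℚ :+ n) :* (x :* y) := x :* y :+ x :* (n :* y)) refl
            (fromℕ (suc k)) (F i e) (coef is K))
          (cong (λ t → F i e * coef is K + F i e * t) (sym tail≡))
          where
          open +-*-Solver
          tail≡ : tail e ≡ fromℕ (suc k) * coef is K
          tail≡ = trans (sym (coef-derivative is (adjust pred e K) e)) (cong₂ _*_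
            (cong (fromℕ ∘ suc) (trans (adjust-≡ pred e K) (cong pred eq)))
            (coef-cong is (adjust-inverse pred suc e K
              (trans (cong (λ n → suc (pred n)) eq) (sym eq)))))
      ... | no e≢u = trans (off-diagonal (K u))
                           (sym (+-identityˡ _))
        where
        off-diagonal : ∀ k → q * (F i u * ifPositive k (coef is (adjust pred u (adjust suc e K)))) ≡
          F i u * ifPositive k (tail u)
        off-diagonal zero = solve 2 (λ a b → a :* (b :* con 0ℚ) := b :* con 0ℚ) refl q (F i u)
          where open +-*-Solver
        off-diagonal (suc k) = trans (*-swapˡ q (F i u) _) (cong (F i u *_) (begin
          q * coef is (adjust pred u (adjust suc e K))
            ≡⟨ cong₂ _*_ (cong (fromℕ ∘ suc) (sym (adjust-≢ pred K (e≢u ∘ sym))))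
                         (coef-cong is (adjust-comm suc pred K e≢u)) ⟩
          fromℕ (suc (adjust pred u K e)) * coef is (adjust suc e (adjust pred u K))
            ≡⟨ coef-derivative is (adjust pred u K) e ⟩
          tail u ∎))

    multiplicityFactorials : List A → ℚ
    multiplicityFactorials []      = 1ℚ
    multiplicityFactorials (e ∷ w) = multiplicityFactorials w * fromℕ (suc (multiplicity w e))

    -- Differentiating along `w` and evaluating at the origin isolates the monomial of `w`, with the
    -- factorials of its exponents as factor.
    polar≡coef : ∀ is w → polar F is w ≡ multiplicityFactorials w * coef is (multiplicity w)
    polar≡coef [] [] = sym (trans (*-identityˡ _) (∏-one es))
      where
      ∏-one : ∀ (xs : List A) → ∏ xs (λ _ → 1ℚ) ≡ 1ℚ
      ∏-one []       = refl
      ∏-one (x ∷ xs) = trans (*-identityˡ _) (∏-one xs)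
    polar≡coef (i ∷ is) [] = sym (trans (*-identityˡ _)
      (trans (∑-cong es (λ e → *-zeroʳ (F i e))) (∑-zero es)))
    polar≡coef is (e ∷ w) = begin
      ∑ (picks is) (λ (i , js) → F i e * polar F js w)
        ≡⟨ ∑-cong (picks is) (λ (i , js) →
             trans (cong (F i e *_) (polar≡coef js w)) (*-swapˡ (F i e) κ _)) ⟩
      ∑ (picks is) (λ (i , js) → κ * (F i e * coef js K))
        ≡⟨ ∑-*ˡ κ (picks is) _ ⟩
      κ * ∑ (picks is) (λ (i , js) → F i e * coef js K)
        ≡⟨ cong (κ *_) (coef-derivative is K e) ⟨
      κ * (fromℕ (suc (K e)) * coef is (adjust suc e K))
        ≡⟨ *-assoc κ _ _ ⟨
      multiplicityFactorials (e ∷ w) * coef is (adjust suc e K) ∎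
      where
      open ≡-Reasoning
      κ = multiplicityFactorials w
      K = multiplicity w

    degree-multiplicity : ∀ w → degree (multiplicity w) es ≡ length w
    degree-multiplicity []      = degree-0 es
      where
      degree-0 : ∀ xs → degree (λ _ → 0) xs ≡ 0
      degree-0 []       = refl
      degree-0 (x ∷ xs) = degree-0 xs
    degree-multiplicity (e ∷ w) = trans
      (degree-suc (multiplicity (e ∷ w)) (multiplicity w) unique (complete e)
        (adjust-≡ suc e (multiplicity w)) (λ x → adjust-≢ suc (multiplicity w)))
      (cong suc (degree-multiplicity w))

    degree-pred : ∀ {K e k} → K e ≡ suc k → degree K es ≡ suc (degree (adjust pred e K) es)
    degree-pred {K} {e} eq = degree-suc K (adjust pred e K) unique (complete e)
      (trans eq (cong suc (sym (trans (adjust-≡ pred e K) (cong pred eq)))))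
      (λ x e≢x → sym (adjust-≢ pred K e≢x))

    -- Each form accounts for one unit of degree. This is why divided differences of total order
    -- above the number of factors will give 0.
    coef-vanishes : ∀ is K → length is ℕ.< degree K es → coef is K ≡ 0ℚ
    coef-vanishes [] K 0<deg = go es 0<deg
      where
      go : ∀ xs → 0 ℕ.< degree K xs → constantTerm K xs ≡ 0ℚ
      go (x ∷ xs) 0<d with K x
      ... | zero  = trans (*-identityˡ _) (go xs 0<d)
      ... | suc _ = *-zeroˡ (constantTerm K xs)
    coef-vanishes (i ∷ is) K len< = trans (∑-cong es (λ e →
      trans (cong (F i e *_) (vanish e (K e) refl)) (*-zeroʳ (F i e)))) (∑-zero es)
      where
      vanish : ∀ e k → K e ≡ k → ifPositive k (coef is (adjust pred e K)) ≡ 0ℚ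
      vanish e zero    eq = refl
      vanish e (suc k) eq = coef-vanishes is (adjust pred e K)
        (ℕ.s≤s⁻¹ (subst (length (i ∷ is) ℕ.<_) (degree-pred eq) len<))

    -- The coefficient as a weighted sum over the grid.

    module Evaluation (p : A → Fin 3 → ℚ) where

      assign : (A → Fin 3) → A → Fin 3 → A → Fin 3
      assign c e i = adjust (λ _ → i) e c

      -- The tensor product of divided differences, of order `K e` in the variable `e`. The
      -- assignment `c` supplies the variables that are not summed over.
      functional : (A → ℕ) → List A → ((A → Fin 3) → ℚ) → (A → Fin 3) → ℚ
      functional K []       P c = P c
      functional K (e ∷ xs) P c =
        ∑ choices (λ i → weight (p e) (K e) i * functional K xs P (assign c e i))

      functional-cong : ∀ K xs {P Q} → (∀ c → P c ≡ Q c) → ∀ c →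
        functional K xs P c ≡ functional K xs Q c
      functional-cong K []       P≡Q c = P≡Q c
      functional-cong K (e ∷ xs) P≡Q c = ∑-cong choices (λ i →
        cong (weight (p e) (K e) i *_) (functional-cong K xs P≡Q (assign c e i)))

      functional-congˡ : ∀ {K K′ xs} → All (λ e → K e ≡ K′ e) xs → ∀ P c →
        functional K xs P c ≡ functional K′ xs P c
      functional-congˡ []                           P c = refl
      functional-congˡ {xs = e ∷ xs} (K≡K′ ∷ eqs) P c = ∑-cong choices (λ i →
        cong₂ (λ k → weight (p e) k i *_) K≡K′ (functional-congˡ eqs P (assign c e i)))

      functional-+ : ∀ K xs P Q c → functional K xs (λ c → P c + Q c) c ≡
        functional K xs P c + functional K xs Q c
      functional-+ K []       P Q c = refl
      functional-+ K (e ∷ xs) P Q c = trans (∑-cong choices (λ i →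
          trans (cong (weight (p e) (K e) i *_) (functional-+ K xs P Q (assign c e i)))
                (*-distribˡ-+ (weight (p e) (K e) i) _ _)))
        (∑-+ choices (λ i → weight (p e) (K e) i * functional K xs P (assign c e i)) _)

      functional-* : ∀ K xs a P c → functional K xs (λ c → a * P c) c ≡
        a * functional K xs P c
      functional-* K []       a P c = refl
      functional-* K (e ∷ xs) a P c = trans (∑-cong choices (λ i →
          trans (cong (weight (p e) (K e) i *_) (functional-* K xs a P (assign c e i)))
                (*-swapˡ (weight (p e) (K e) i) a _)))
        (∑-*ˡ a choices _)

      functional-∑ : ∀ K xs (ys : List B) (P : B → (A → Fin 3) → ℚ) c →
        functional K xs (λ c → ∑ ys (λ y → P y c)) c ≡ ∑ ys (λ y → functional K xs (P y) c)
      functional-∑ K xs []       P c = trans (functional-* K xs 0ℚ (λ _ → 0ℚ) c)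
        (*-zeroˡ (functional K xs (λ _ → 0ℚ) c))
      functional-∑ K xs (y ∷ ys) P c = trans (functional-+ K xs (P y) _ c)
        (cong (functional K xs (P y) c +_) (functional-∑ K xs ys P c))

      functional-1 : ∀ K xs c → functional K xs (λ _ → 1ℚ) c ≡ constantTerm K xs
      functional-1 K []       c = refl
      functional-1 K (e ∷ xs) c = trans (∑-cong choices (λ i →
          cong (weight (p e) (K e) i *_) (functional-1 K xs (assign c e i))))
        (trans (∑-*ʳ (constantTerm K xs) choices (weight (p e) (K e)))
               (cong (_* constantTerm K xs) (∑-weight (p e) (K e))))

      -- As `e` is not summed over, its value is a constant factor.
      functional-outside : ∀ K {xs e} → All (e ≢_) xs → ∀ P c →
        functional K xs (λ c → p e (c e) * P c) c ≡ p e (c e) * functional K xs P c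
      functional-outside K []               P c = refl
      functional-outside K {x ∷ xs} {e} (e≢x ∷ e∉xs) P c =
        trans (∑-cong choices (λ i →
          trans (cong (weight (p x) (K x) i *_) (trans (functional-outside K e∉xs P (assign c x i))
                  (cong (λ j → p e j * functional K xs P (assign c x i))
                        (adjust-≢ (λ _ → i) c (e≢x ∘ sym)))))
                (*-swapˡ (weight (p x) (K x) i) (p e (c e)) _)))
          (∑-*ˡ (p e (c e)) choices _)

      -- `weight-shift` in the variable `e`, with the sums over the other variables carried along.
      functional-shift : ∀ K {xs e} → Unique xs → e ∈ xs → K e ℕ.≤ 2 → ∀ P c →
        functional K xs (λ c → p e (c e) * P c) c ≡
        node (p e) (K e) * functional K xs P c +
        gap (p e) (K e) * functional (adjust pred e K) xs P c
      functional-shift K {e ∷ xs} (e∉xs ∷ _) (here refl) Ke≤2 P c = begin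
        ∑ choices (λ i → W (K e) i * functional K xs (λ c → p e (c e) * P c) (assign c e i))
          ≡⟨ ∑-cong choices (λ i → cong (W (K e) i *_) (inner i)) ⟩
        ∑ choices (λ i → W (K e) i * (p e i * V i))
          ≡⟨ ∑-cong choices (λ i → trans (sym (*-assoc (W (K e) i) (p e i) (V i)))
               (trans (cong (_* V i) (weight-shift (p e) Ke≤2 i))
                      (rearrange (node (p e) (K e)) (W (K e) i)
                                 (gap (p e) (K e)) (W (pred (K e)) i) (V i)))) ⟩
        ∑ choices (λ i → node (p e) (K e) * (W (K e) i * V i) +
                            gap (p e) (K e) * (W (pred (K e)) i * V i))
          ≡⟨ ∑-+ choices (λ i → node (p e) (K e) * (W (K e) i * V i)) _ ⟩
        ∑ choices (λ i → node (p e) (K e) * (W (K e) i * V i)) +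
        ∑ choices (λ i → gap (p e) (K e) * (W (pred (K e)) i * V i))
          ≡⟨ cong₂ _+_ (∑-*ˡ (node (p e) (K e)) choices _)
               (trans (∑-*ˡ (gap (p e) (K e)) choices _)
                 (cong (gap (p e) (K e) *_) (∑-cong choices lowered))) ⟩
        node (p e) (K e) * functional K (e ∷ xs) P c +
        gap (p e) (K e) * functional (adjust pred e K) (e ∷ xs) P c ∎
        where
        open ≡-Reasoning
        W = weight (p e)
        V : Fin 3 → ℚ
        V i = functional K xs P (assign c e i)
        inner : ∀ i → functional K xs (λ c → p e (c e) * P c) (assign c e i) ≡ p e i * V i
        inner i = trans (functional-outside K e∉xs P (assign c e i))
                        (cong (λ j → p e j * V i) (adjust-≡ (λ _ → i) e c))
        lowered : ∀ i → W (pred (K e)) i * V i ≡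
          W (adjust pred e K e) i * functional (adjust pred e K) xs P (assign c e i)
        lowered i = cong₂ (λ k → W k i *_) (sym (adjust-≡ pred e K))
          (functional-congˡ (All.map (λ e≢x → sym (adjust-≢ pred K e≢x)) e∉xs) P (assign c e i))
        rearrange : ∀ n w g w′ v → (n * w + g * w′) * v ≡ n * (w * v) + g * (w′ * v)
        rearrange = solve 5 (λ n w g w′ v →
          (n :* w :+ g :* w′) :* v := n :* (w :* v) :+ g :* (w′ :* v)) refl
          where open +-*-Solver
      functional-shift K {x ∷ xs} {e} (x∉xs ∷ u) (there e∈xs) Ke≤2 P c = begin
        ∑ choices (λ i → W i * functional K xs (λ c → p e (c e) * P c) (assign c x i))
          ≡⟨ ∑-cong choices (λ i →
               trans (cong (W i *_) (functional-shift K u e∈xs Ke≤2 P (assign c x i)))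
                     (rearrange (W i) (node (p e) (K e)) (functional K xs P (assign c x i))
                                (gap (p e) (K e)) _)) ⟩
        ∑ choices (λ i → node (p e) (K e) * (W i * functional K xs P (assign c x i)) +
                            gap (p e) (K e) *
                              (W i * functional (adjust pred e K) xs P (assign c x i)))
          ≡⟨ ∑-+ choices (λ i → node (p e) (K e) * (W i * functional K xs P (assign c x i))) _ ⟩
        ∑ choices (λ i → node (p e) (K e) * (W i * functional K xs P (assign c x i))) +
        ∑ choices (λ i → gap (p e) (K e) * (W i * functional (adjust pred e K) xs P (assign c x i)))
          ≡⟨ cong₂ _+_ (∑-*ˡ (node (p e) (K e)) choices _)
               (trans (∑-*ˡ (gap (p e) (K e)) choices _)
                 (cong (gap (p e) (K e) *_) (∑-cong choices (λ i →
                   cong (λ k → weight (p x) k i * functional (adjust pred e K) xs P (assign c x i))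
                        (sym (adjust-≢ pred K e≢x)))))) ⟩
        node (p e) (K e) * functional K (x ∷ xs) P c +
        gap (p e) (K e) * functional (adjust pred e K) (x ∷ xs) P c ∎
        where
        open ≡-Reasoning
        W = weight (p x) (K x)
        e≢x : e ≢ x
        e≢x e≡x = All.lookup x∉xs e∈xs (sym e≡x)
        rearrange : ∀ w n v g v′ → w * (n * v + g * v′) ≡ n * (w * v) + g * (w * v′)
        rearrange = solve 5 (λ w n v g v′ →
          w :* (n :* v :+ g :* v′) := n :* (w :* v) :+ g :* (w :* v′)) refl
          where open +-*-Solver

      scaleProduct : (A → ℕ) → List A → ℚ
      scaleProduct K xs = ∏ xs (λ e → scale (p e) (K e))

      scaleProduct-pred : ∀ K {xs e k} → Unique xs → e ∈ xs → K e ≡ suc k →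
        scaleProduct K xs ≡ gap (p e) (suc k) * scaleProduct (adjust pred e K) xs
      scaleProduct-pred K {e ∷ xs} {e} {k} (e∉xs ∷ _) (here refl) eq = trans
        (cong₂ _*_ (cong (scale (p e)) eq) (off e∉xs))
        (trans (*-assoc (gap (p e) (suc k)) (scale (p e) k) _)
          (cong (λ m → gap (p e) (suc k) * (scale (p e) m * scaleProduct (adjust pred e K) xs))
                (sym (trans (adjust-≡ pred e K) (cong pred eq)))))
        where
        off : ∀ {ys} → All (e ≢_) ys → scaleProduct K ys ≡ scaleProduct (adjust pred e K) ys
        off []           = refl
        off {y ∷ ys} (e≢y ∷ e∉ys) =
          cong₂ (λ m → scale (p y) m *_) (sym (adjust-≢ pred K e≢y)) (off e∉ys)
      scaleProduct-pred K {x ∷ xs} {e} {k} (x∉xs ∷ u) (there e∈xs) eq = trans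
        (cong₂ (λ m → scale (p x) m *_)
          (sym (adjust-≢ pred K (λ e≡x → All.lookup x∉xs e∈xs (sym e≡x))))
          (scaleProduct-pred K u e∈xs eq))
        (*-swapˡ (scale (p x) (adjust pred e K x)) (gap (p e) (suc k)) _)

      -- The affine form with linear part `F i` at the list elements chosen by `c`. The constants
      -- `γ` will hold the contribution of the vertex weights.
      value : (I → ℚ) → I → (A → Fin 3) → ℚ
      value γ i c = γ i + ∑ es (λ e → F i e * p e (c e))

      -- By `functional-shift` each variable gives a multiple of the functional at `K` itself and a
      -- term of lower order. The hypothesis removes the former along with the constant `γ i`.
      functional-value : ∀ γ K → (∀ e → K e ℕ.≤ 2) → ∀ i P c → functional K es P c ≡ 0ℚ →
        functional K es (λ c → value γ i c * P c) c ≡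
        ∑ es (λ e → F i e * (gap (p e) (K e) * functional (adjust pred e K) es P c))
      functional-value γ K K≤2 i P c vanish = begin
        functional K es (λ c → value γ i c * P c) c
          ≡⟨ functional-cong K es (λ c → trans (*-distribʳ-+ (P c) (γ i) _)
               (cong (γ i * P c +_) (trans (sym (∑-*ʳ (P c) es _))
                 (∑-cong es (λ e → *-assoc (F i e) (p e (c e)) (P c)))))) c ⟩
        functional K es (λ c → γ i * P c + ∑ es (λ e → F i e * (p e (c e) * P c))) c
          ≡⟨ functional-+ K es (λ c → γ i * P c) _ c ⟩
        functional K es (λ c → γ i * P c) c +
        functional K es (λ c → ∑ es (λ e → F i e * (p e (c e) * P c))) c
          ≡⟨ cong₂ _+_ (trans (functional-* K es (γ i) P c) (annihilate (γ i)))
               (functional-∑ K es es (λ e c → F i e * (p e (c e) * P c)) c) ⟩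
        0ℚ + ∑ es (λ e → functional K es (λ c → F i e * (p e (c e) * P c)) c)
          ≡⟨ +-identityˡ _ ⟩
        ∑ es (λ e → functional K es (λ c → F i e * (p e (c e) * P c)) c)
          ≡⟨ ∑-cong es (λ e → trans (functional-* K es (F i e) (λ c → p e (c e) * P c) c)
               (cong (F i e *_) (trans (functional-shift K unique (complete e) (K≤2 e) P c)
                 (trans (cong (_+ gap (p e) (K e) * functional (adjust pred e K) es P c)
                              (annihilate (node (p e) (K e))))
                        (+-identityˡ (gap (p e) (K e) * functional (adjust pred e K) es P c)))))) ⟩
        ∑ es (λ e → F i e * (gap (p e) (K e) * functional (adjust pred e K) es P c)) ∎
        where
        open ≡-Reasoning
        annihilate : ∀ a → a * functional K es P c ≡ 0ℚ
        annihilate a = trans (cong (a *_) vanish) (*-zeroʳ a)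

      -- The Combinatorial Nullstellensatz as an identity, by induction on the factors. Without its
      -- first factor the product has fewer factors than the degree of `K`, so `coef-vanishes`
      -- supplies the vanishing that `functional-value` asks for.
      functional-∏ : ∀ γ is K → (∀ e → K e ℕ.≤ 2) → length is ℕ.≤ degree K es → ∀ c →
        functional K es (λ c → ∏ is (λ i → value γ i c)) c ≡ scaleProduct K es * coef is K
      functional-∏ γ [] K K≤2 _ c = trans (functional-1 K es c) (absorb es)
        where
        -- At exponent 0 the scale is 1; at a positive exponent both sides are 0.
        absorb : ∀ xs → constantTerm K xs ≡ scaleProduct K xs * constantTerm K xs
        absorb []       = refl
        absorb (x ∷ xs) = trans (cong₂ _*_ (unscaled (K x)) (absorb xs))
          (*-interchange (scale (p x) (K x)) (isZero (K x)) (scaleProduct K xs) (constantTerm K xs))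
          where
          unscaled : ∀ k → isZero k ≡ scale (p x) k * isZero k
          unscaled zero    = refl
          unscaled (suc k) = sym (*-zeroʳ (scale (p x) (suc k)))
      functional-∏ γ (i ∷ is) K K≤2 len≤ c = begin
        functional K es (λ c → value γ i c * ∏ is (λ i → value γ i c)) c
          ≡⟨ functional-value γ K K≤2 i _ c (trans (functional-∏ γ is K K≤2 (ℕ.<⇒≤ len≤) c)
               (trans (cong (scaleProduct K es *_) (coef-vanishes is K len≤))
                      (*-zeroʳ (scaleProduct K es)))) ⟩
        ∑ es (λ e → F i e * (gap (p e) (K e) *
          functional (adjust pred e K) es (λ c → ∏ is (λ i → value γ i c)) c))
          ≡⟨ ∑-cong es (λ e → trans (cong (F i e *_) (term e (K e) refl))
               (*-swapˡ (F i e) (scaleProduct K es) _)) ⟩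
        ∑ es (λ e → scaleProduct K es * (F i e * ifPositive (K e) (coef is (adjust pred e K))))
          ≡⟨ ∑-*ˡ (scaleProduct K es) es _ ⟩
        scaleProduct K es * coef (i ∷ is) K ∎
        where
        open ≡-Reasoning
        lower≤2 : ∀ e x → adjust pred e K x ℕ.≤ 2
        lower≤2 e x with e ≟ x
        ... | yes _ = ℕ.≤-trans ℕ.pred[n]≤n (K≤2 x)
        ... | no _  = K≤2 x
        term : ∀ e k → K e ≡ k →
          gap (p e) k * functional (adjust pred e K) es (λ c → ∏ is (λ i → value γ i c)) c ≡
          scaleProduct K es * ifPositive k (coef is (adjust pred e K))
        term e zero    eq = trans
          (*-zeroˡ (functional (adjust pred e K) es (λ c → ∏ is (λ i → value γ i c)) c))
          (sym (*-zeroʳ (scaleProduct K es)))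
        term e (suc k) eq = trans
          (cong (gap (p e) (suc k) *_) (functional-∏ γ is (adjust pred e K) (lower≤2 e)
            (ℕ.s≤s⁻¹ (subst (length (i ∷ is) ℕ.≤_) (degree-pred eq) len≤)) c))
          (trans (sym (*-assoc (gap (p e) (suc k)) _ _))
                 (cong (_* coef is (adjust pred e K))
                       (sym (scaleProduct-pred K unique (complete e) eq))))

-- Cauchy sequences and apartness from 0.

-- Records, so that the sequence can be inferred from its property.

record Cauchy (x : ℕ → ℚ) : Set where
  constructor mkCauchy
  field isCauchy : IsCauchy x

open Cauchy

record NonVanishing (x : ℕ → ℚ) : Set where
  constructor nonVanishing
  field
    ε     : ℚ
    0<ε   : 0ℚ < ε
    N     : ℕ
    bound : ∀ n → N ℕ.≤ n → ε ≤ ∣ x n ∣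

record EventuallyBounded (x : ℕ → ℚ) : Set where
  constructor eventuallyBounded
  field
    limit   : ℚ
    0<limit : 0ℚ < limit
    N       : ℕ
    bound   : ∀ n → N ℕ.≤ n → ∣ x n ∣ ≤ limit

0<½*p : ∀ {p} → 0ℚ < p → 0ℚ < ½ * p
0<½*p 0<p = 0<p*q (positive⁻¹ ½) 0<p

½*p+½*p≡p : ∀ p → ½ * p + ½ * p ≡ p
½*p+½*p≡p p = trans (sym (*-distribʳ-+ p ½ ½)) (*-identityˡ p)

½*p<p : ∀ {p} → 0ℚ < p → ½ * p < p
½*p<p {p} 0<p = begin-strict
  ½ * p          ≡⟨ +-identityˡ (½ * p) ⟨
  0ℚ + ½ * p     <⟨ +-monoˡ-< (½ * p) (0<½*p 0<p) ⟩
  ½ * p + ½ * p  ≡⟨ ½*p+½*p≡p p ⟩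
  p              ∎
  where open ≤-Reasoning

divide : ∀ {ε B} → 0ℚ < ε → 0ℚ < B → Σ[ δ ∈ ℚ ] (0ℚ < δ × δ * B ≡ ε)
divide {ε} {B} 0<ε 0<B = ε * (1/ B) ,
  0<p*q 0<ε (positive⁻¹ (1/ B) {{1/pos⇒pos B}}) ,
  trans (*-assoc ε (1/ B) B) (trans (cong (ε *_) (*-inverseˡ B)) (*-identityʳ ε))
  where
  instance
    B-pos = positive 0<B
    B-nz = pos⇒nonZero B

*-mono-≤-nonNeg : ∀ {a b c d} → 0ℚ ≤ c → 0ℚ ≤ b → a ≤ b → c ≤ d → a * c ≤ b * d
*-mono-≤-nonNeg {a} {b} {c} {d} 0≤c 0≤b a≤b c≤d =
  ≤-trans (*-monoʳ-≤-nonNeg c {{nonNegative 0≤c}} a≤b)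
          (*-monoˡ-≤-nonNeg b {{nonNegative 0≤b}} c≤d)

cauchy-const : ∀ c → Cauchy (λ _ → c)
cauchy-const c = mkCauchy λ ε 0<ε →
  0 , λ _ _ _ _ → subst (_< ε) (sym (cong ∣_∣ (+-inverseʳ c))) 0<ε

cauchy-+ : ∀ {x y : ℕ → ℚ} → Cauchy x → Cauchy y → Cauchy (λ n → x n + y n)
cauchy-+ {x} {y} cx cy = mkCauchy (cauchy (mkℝ x (isCauchy cx) +ℝ mkℝ y (isCauchy cy)))

cauchy-neg : ∀ {x : ℕ → ℚ} → Cauchy x → Cauchy (λ n → - x n)
cauchy-neg {x} cx = mkCauchy λ ε 0<ε →
  let N , p = isCauchy cx ε 0<ε
  in N , λ m n m≥ n≥ → subst (_< ε)
    (trans (sym (∣-p∣≡∣p∣ (x m - x n))) (cong ∣_∣ (neg-distrib-+ (x m) (- x n))))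
    (p m n m≥ n≥)

cauchy-sub : ∀ {x y : ℕ → ℚ} → Cauchy x → Cauchy y → Cauchy (λ n → x n - y n)
cauchy-sub cx cy = cauchy-+ cx (cauchy-neg cy)

p≡[p-q]+q : ∀ p q → p ≡ (p - q) + q
p≡[p-q]+q = solve 2 (λ a b → a := (a :- b) :+ b) refl
  where open +-*-Solver

cauchy-bounded : ∀ {x : ℕ → ℚ} → Cauchy x → EventuallyBounded x
cauchy-bounded {x} cx =
  let N , p = isCauchy cx 1ℚ (positive⁻¹ 1ℚ)
  in eventuallyBounded (1ℚ + ∣ x N ∣) (+-mono-<-≤ (positive⁻¹ 1ℚ) (0≤∣p∣ (x N))) N λ n n≥ → begin
    ∣ x n ∣                   ≡⟨ cong ∣_∣ (p≡[p-q]+q (x n) (x N)) ⟩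
    ∣ (x n - x N) + x N ∣     ≤⟨ ∣p+q∣≤∣p∣+∣q∣ (x n - x N) (x N) ⟩
    ∣ x n - x N ∣ + ∣ x N ∣   ≤⟨ +-monoˡ-≤ ∣ x N ∣ (<⇒≤ (p n N n≥ ℕ.≤-refl)) ⟩
    1ℚ + ∣ x N ∣              ∎
  where open ≤-Reasoning

∣ab-cd∣≤ : ∀ {a b c d δ γ B C} → ∣ a - c ∣ ≤ δ → ∣ b ∣ ≤ B → ∣ b - d ∣ ≤ γ → ∣ c ∣ ≤ C →
  ∣ a * b - c * d ∣ ≤ δ * B + γ * C
∣ab-cd∣≤ {a} {b} {c} {d} {δ} {γ} {B} {C} p q r s = begin
  ∣ a * b - c * d ∣
    ≡⟨ cong ∣_∣ (split a b c d) ⟩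
  ∣ (a - c) * b + (b - d) * c ∣
    ≤⟨ ∣p+q∣≤∣p∣+∣q∣ ((a - c) * b) ((b - d) * c) ⟩
  ∣ (a - c) * b ∣ + ∣ (b - d) * c ∣
    ≡⟨ cong₂ _+_ (∣p*q∣≡∣p∣*∣q∣ (a - c) b) (∣p*q∣≡∣p∣*∣q∣ (b - d) c) ⟩
  ∣ a - c ∣ * ∣ b ∣ + ∣ b - d ∣ * ∣ c ∣
    ≤⟨ +-mono-≤ (*-mono-≤-nonNeg (0≤∣p∣ b) (≤-trans (0≤∣p∣ (a - c)) p) p q)
                (*-mono-≤-nonNeg (0≤∣p∣ c) (≤-trans (0≤∣p∣ (b - d)) r) r s) ⟩
  δ * B + γ * C ∎
  where
  open ≤-Reasoning
  split : ∀ a b c d → a * b - c * d ≡ (a - c) * b + (b - d) * c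
  split = solve 4 (λ a b c d → a :* b :- c :* d := (a :- c) :* b :+ (b :- d) :* c) refl
    where open +-*-Solver

cauchy-* : ∀ {x y : ℕ → ℚ} → Cauchy x → Cauchy y → Cauchy (λ n → x n * y n)
cauchy-* {x} {y} cx cy = mkCauchy λ ε 0<ε → close ε 0<ε (cauchy-bounded cx) (cauchy-bounded cy)
  where
  module _ (ε : ℚ) (0<ε : 0ℚ < ε) where
    -- A quarter of ε: `∣ab-cd∣≤` bounds the difference only weakly, so the two contributions must
    -- add up to strictly less than ε.
    η = ½ * (½ * ε)
    0<η : 0ℚ < η
    0<η = 0<½*p (0<½*p 0<ε)
    η+η<ε : η + η < ε
    η+η<ε = subst (_< ε) (sym (½*p+½*p≡p (½ * ε))) (½*p<p 0<ε)
    close : EventuallyBounded x → EventuallyBounded y →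
      ∃[ N ] (∀ m n → N ℕ.≤ m → N ℕ.≤ n → ∣ x m * y m - x n * y n ∣ < ε)
    close (eventuallyBounded B 0<B M x≤B) (eventuallyBounded C 0<C N y≤C) =
      let δ , 0<δ , δC≡η = divide 0<η 0<C
          γ , 0<γ , γB≡η = divide 0<η 0<B
          M′ , x-x<δ = isCauchy cx δ 0<δ
          N′ , y-y<γ = isCauchy cy γ 0<γ
      in (M ℕ.⊔ N) ℕ.⊔ (M′ ℕ.⊔ N′) , λ m n m≥ n≥ →
        let m≥₁ = ℕ.m⊔n≤o⇒m≤o (M ℕ.⊔ N) (M′ ℕ.⊔ N′) m≥
            m≥₂ = ℕ.m⊔n≤o⇒n≤o (M ℕ.⊔ N) (M′ ℕ.⊔ N′) m≥
            n≥₁ = ℕ.m⊔n≤o⇒m≤o (M ℕ.⊔ N) (M′ ℕ.⊔ N′) n≥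
            n≥₂ = ℕ.m⊔n≤o⇒n≤o (M ℕ.⊔ N) (M′ ℕ.⊔ N′) n≥
        in ≤-<-trans
          (∣ab-cd∣≤ {x m} {y m} {x n} {y n}
            (<⇒≤ (x-x<δ m n (ℕ.m⊔n≤o⇒m≤o M′ N′ m≥₂) (ℕ.m⊔n≤o⇒m≤o M′ N′ n≥₂)))
            (y≤C m (ℕ.m⊔n≤o⇒n≤o M N m≥₁))
            (<⇒≤ (y-y<γ m n (ℕ.m⊔n≤o⇒n≤o M′ N′ m≥₂) (ℕ.m⊔n≤o⇒n≤o M′ N′ n≥₂)))
            (x≤B n (ℕ.m⊔n≤o⇒m≤o M N n≥₁)))
          (subst (_< ε) (sym (cong₂ _+_ δC≡η γB≡η)) η+η<ε)

cauchy-∑ : ∀ (xs : List A) {f : A → ℕ → ℚ} → (∀ a → Cauchy (f a)) →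
  Cauchy (λ n → ∑ xs (λ a → f a n))
cauchy-∑ []           cf = cauchy-const 0ℚ
cauchy-∑ (x ∷ xs) {f} cf = cauchy-+ {f x} (cf x) (cauchy-∑ xs cf)

cauchy-∏ : ∀ (xs : List A) {f : A → ℕ → ℚ} → (∀ a → Cauchy (f a)) →
  Cauchy (λ n → ∏ xs (λ a → f a n))
cauchy-∏ []           cf = cauchy-const 1ℚ
cauchy-∏ (x ∷ xs) {f} cf = cauchy-* {f x} (cf x) (cauchy-∏ xs cf)

nonVanishing-const : ∀ {c} → c ≢ 0ℚ → NonVanishing (λ _ → c)
nonVanishing-const {c} c≢0 = nonVanishing ∣ c ∣ 0<∣c∣ 0 (λ _ _ → ≤-refl)
  where
  0<∣c∣ : 0ℚ < ∣ c ∣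
  0<∣c∣ = ≰⇒> (λ ∣c∣≤0 → c≢0 (∣p∣≡0⇒p≡0 c (≤-antisym ∣c∣≤0 (0≤∣p∣ c))))

nonVanishing-cong : ∀ {x y : ℕ → ℚ} → (∀ n → x n ≡ y n) → NonVanishing x → NonVanishing y
nonVanishing-cong x≡y (nonVanishing ε 0<ε N p) =
  nonVanishing ε 0<ε N λ n n≥ → subst (ε ≤_) (cong ∣_∣ (x≡y n)) (p n n≥)

nonVanishing-sub-comm : ∀ {x y : ℕ → ℚ} →
  NonVanishing (λ n → x n - y n) → NonVanishing (λ n → y n - x n)
nonVanishing-sub-comm {x} {y} (nonVanishing ε 0<ε N p) = nonVanishing ε 0<ε N λ n n≥ →
  subst (ε ≤_) (trans (sym (∣-p∣≡∣p∣ (x n - y n))) (cong ∣_∣ (flip (x n) (y n)))) (p n n≥)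
  where
  flip : ∀ a b → - (a - b) ≡ b - a
  flip = solve 2 (λ a b → :- (a :- b) := b :- a) refl
    where open +-*-Solver

nonVanishing-* : ∀ {x y : ℕ → ℚ} → NonVanishing x → NonVanishing y → NonVanishing (λ n → x n * y n)
nonVanishing-* {x} {y} (nonVanishing ε 0<ε M p) (nonVanishing δ 0<δ N q) =
  nonVanishing (ε * δ) (0<p*q 0<ε 0<δ) (M ℕ.⊔ N) λ n n≥ →
    subst (ε * δ ≤_) (sym (∣p*q∣≡∣p∣*∣q∣ (x n) (y n)))
      (*-mono-≤-nonNeg (<⇒≤ 0<δ) (0≤∣p∣ (x n))
        (p n (ℕ.m⊔n≤o⇒m≤o M N n≥)) (q n (ℕ.m⊔n≤o⇒n≤o M N n≥)))

nonVanishing-∏ : ∀ (xs : List A) {f : A → ℕ → ℚ} → (∀ a → NonVanishing (f a)) →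
  NonVanishing (λ n → ∏ xs (λ a → f a n))
nonVanishing-∏ []           nf = nonVanishing-const {1ℚ} (λ ())
nonVanishing-∏ (x ∷ xs) {f} nf = nonVanishing-* {f x} (nf x) (nonVanishing-∏ xs nf)

-- If the Cauchy factor is eventually at most B in size and the product at least ε, then the other
-- factor is at least ε/B.
nonVanishing-*⁻ʳ : ∀ {x y : ℕ → ℚ} → Cauchy x → NonVanishing (λ n → x n * y n) → NonVanishing y
nonVanishing-*⁻ʳ {x} {y} cx (nonVanishing ε 0<ε M p) =
  let eventuallyBounded B 0<B N x≤B = cauchy-bounded cx
      δ , 0<δ , δB≡ε = divide 0<ε 0<B
  in nonVanishing δ 0<δ (M ℕ.⊔ N) λ n n≥ →
    bound {x n} {y n} 0<B δB≡ε (p n (ℕ.m⊔n≤o⇒m≤o M N n≥)) (x≤B n (ℕ.m⊔n≤o⇒n≤o M N n≥))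
  where
  open ≤-Reasoning
  bound : ∀ {a b B δ} → 0ℚ < B → δ * B ≡ ε → ε ≤ ∣ a * b ∣ → ∣ a ∣ ≤ B → δ ≤ ∣ b ∣
  bound {a} {b} {B} {δ} 0<B δB≡ε ε≤ a≤B = *-cancelʳ-≤-pos B {{positive 0<B}} (begin
    δ * B          ≡⟨ δB≡ε ⟩
    ε              ≤⟨ ε≤ ⟩
    ∣ a * b ∣      ≡⟨ ∣p*q∣≡∣p∣*∣q∣ a b ⟩
    ∣ a ∣ * ∣ b ∣  ≡⟨ *-comm ∣ a ∣ ∣ b ∣ ⟩
    ∣ b ∣ * ∣ a ∣  ≤⟨ *-monoˡ-≤-nonNeg ∣ b ∣ {{nonNegative (0≤∣p∣ b)}} a≤B ⟩
    ∣ b ∣ * B      ∎)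

nonVanishing-*⁻ˡ : ∀ {x y : ℕ → ℚ} → Cauchy y → NonVanishing (λ n → x n * y n) → NonVanishing x
nonVanishing-*⁻ˡ {x} {y} cy nv =
  nonVanishing-*⁻ʳ {y} cy (nonVanishing-cong (λ n → *-comm (x n) (y n)) nv)

nonVanishing-∏⁻ : ∀ {xs : List A} {f : A → ℕ → ℚ} → (∀ a → Cauchy (f a)) →
  NonVanishing (λ n → ∏ xs (λ a → f a n)) → ∀ {a} → a ∈ xs → NonVanishing (f a)
nonVanishing-∏⁻ {xs = x ∷ xs} {f} cf nv (here refl) =
  nonVanishing-*⁻ˡ {f x} (cauchy-∏ xs cf) nv
nonVanishing-∏⁻ {xs = x ∷ xs} {f} cf nv (there a∈) =
  nonVanishing-∏⁻ {xs = xs} cf (nonVanishing-*⁻ʳ {f x} (cf x) nv) a∈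

-- Past the modulus for ε/2, one sample of size at least ε keeps all later values at ε/2 or more.
cauchy-away : ∀ {x ε} → Cauchy x → 0ℚ < ε → ∃[ N ] (∀ n → N ℕ.≤ n → ε ≤ ∣ x n ∣ → NonVanishing x)
cauchy-away {x} {ε} cx 0<ε =
  let N , p = isCauchy cx (½ * ε) (0<½*p 0<ε)
  in N , λ n n≥ ε≤ → nonVanishing (½ * ε) (0<½*p 0<ε) N λ m m≥ →
    ≮⇒≥ (λ small → <-irrefl refl (begin-strict
      ε                         ≤⟨ ε≤ ⟩
      ∣ x n ∣                   ≡⟨ cong ∣_∣ (p≡[p-q]+q (x n) (x m)) ⟩
      ∣ (x n - x m) + x m ∣     ≤⟨ ∣p+q∣≤∣p∣+∣q∣ (x n - x m) (x m) ⟩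
      ∣ x n - x m ∣ + ∣ x m ∣   <⟨ +-mono-< (p n m n≥ m≥) small ⟩
      ½ * ε + ½ * ε             ≡⟨ ½*p+½*p≡p ε ⟩
      ε                         ∎))
  where open ≤-Reasoning

-- If a sum of two rationals has size at least ε, then one of them has size at least ε/2, and
-- comparing rationals decides which. By `cauchy-away`, one sample far enough along settles the
-- matter for the sequence.
nonVanishing-+⁻ : ∀ {x y : ℕ → ℚ} → Cauchy x → Cauchy y → NonVanishing (λ n → x n + y n) →
  NonVanishing x ⊎ NonVanishing y
nonVanishing-+⁻ {x} {y} cx cy (nonVanishing ε 0<ε N p) =
  let Nx , awayˣ = cauchy-away cx (0<½*p 0<ε)
      Ny , awayʸ = cauchy-away cy (0<½*p 0<ε)
      n = N ℕ.⊔ (Nx ℕ.⊔ Ny)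
  in Sum.map (awayˣ n (ℕ.≤-trans (ℕ.m≤m⊔n Nx Ny) (ℕ.m≤n⊔m N (Nx ℕ.⊔ Ny))))
             (awayʸ n (ℕ.≤-trans (ℕ.m≤n⊔m Nx Ny) (ℕ.m≤n⊔m N (Nx ℕ.⊔ Ny))))
             (large (p n (ℕ.m≤m⊔n N (Nx ℕ.⊔ Ny))))
  where
  open ≤-Reasoning
  large : ∀ {a b} → ε ≤ ∣ a + b ∣ → ½ * ε ≤ ∣ a ∣ ⊎ ½ * ε ≤ ∣ b ∣
  large {a} {b} ε≤ with ½ * ε ≤? ∣ a ∣
  ... | yes a-large = inj₁ a-large
  ... | no ¬a-large = inj₂ (≮⇒≥ (λ b-small → <-irrefl refl (begin-strict
    ε                    ≤⟨ ε≤ ⟩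
    ∣ a + b ∣            ≤⟨ ∣p+q∣≤∣p∣+∣q∣ a b ⟩
    ∣ a ∣ + ∣ b ∣        <⟨ +-mono-< (≰⇒> ¬a-large) b-small ⟩
    ½ * ε + ½ * ε        ≡⟨ ½*p+½*p≡p ε ⟩
    ε                    ∎)))

nonVanishing-0⁻ : ¬ NonVanishing (λ _ → 0ℚ)
nonVanishing-0⁻ (nonVanishing ε 0<ε N p) = <-irrefl {0ℚ} refl (<-≤-trans 0<ε (p N ℕ.≤-refl))

nonVanishing-∑⁻ : ∀ (xs : List A) {f : A → ℕ → ℚ} → (∀ a → Cauchy (f a)) →
  NonVanishing (λ n → ∑ xs (λ a → f a n)) → ∃[ a ] NonVanishing (f a)
nonVanishing-∑⁻ []       cf nv = ⊥-elim (nonVanishing-0⁻ nv)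
nonVanishing-∑⁻ (x ∷ xs) {f} cf nv =
  Sum.[ (x ,_) , nonVanishing-∑⁻ xs cf ]′ (nonVanishing-+⁻ (cf x) (cauchy-∑ xs cf) nv)

cauchy-weight : ∀ {q : ℕ → Fin 3 → ℚ} → (∀ i → Cauchy (λ n → q n i)) →
  ∀ k i → Cauchy (λ n → weight (q n) k i)
cauchy-weight cq 0 0F      = cauchy-const 1ℚ
cauchy-weight cq 0 (suc _) = cauchy-const 0ℚ
cauchy-weight cq 1 0F      = cauchy-const (- 1ℚ)
cauchy-weight cq 1 1F      = cauchy-const 1ℚ
cauchy-weight cq 1 2F      = cauchy-const 0ℚ
cauchy-weight cq 2 0F      = cauchy-sub (cq 2F) (cq 1F)
cauchy-weight cq 2 1F      = cauchy-sub (cq 0F) (cq 2F)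
cauchy-weight cq 2 2F      = cauchy-sub (cq 1F) (cq 0F)
cauchy-weight cq (suc (suc (suc _))) 0F      = cauchy-const 0ℚ
cauchy-weight cq (suc (suc (suc _))) (suc _) = cauchy-const 0ℚ

-- Here the distinctness of the list elements enters: the gaps of orders 1 and 2 are products of
-- their differences.
nonVanishing-scale : ∀ {q : ℕ → Fin 3 → ℚ} →
  (∀ i j → i ≢ j → NonVanishing (λ n → q n i - q n j)) →
  ∀ {k} → k ℕ.≤ 2 → NonVanishing (λ n → scale (q n) k)
nonVanishing-scale apart {0} _ = nonVanishing-const {1ℚ} (λ ())
nonVanishing-scale apart {1} _ =
  nonVanishing-* (apart 1F 0F (λ ())) (nonVanishing-const {1ℚ} (λ ()))
nonVanishing-scale {q} apart {2} _ = nonVanishing-*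
  (nonVanishing-* (apart 2F 0F (λ ())) (apart 2F 1F (λ ())))
  (nonVanishing-scale {q} apart {1} (s≤s z≤n))
nonVanishing-scale apart {suc (suc (suc _))} (s≤s (s≤s ()))

-- Exponent bounds and the Nullstellensatz for Cauchy sequences.

module _ (_≟′_ : DecidableEquality A) where
  open Polynomial _≟′_

  -- A nonzero term of the derivative matches the letters of `w` with distinct factors, each
  -- containing the variable of its letter.
  multiplicity-≤ : ∀ (F : I → A → ℚ) is w → polar F is w ≢ 0ℚ → ∀ e →
    multiplicity w e ℕ.≤ length (filter (λ i → ¬? (F i e ≟ 0ℚ)) is)
  multiplicity-≤ F is []      _   e = z≤n
  multiplicity-≤ F is (a ∷ w) T≢0 e with ∑≢0⇒∃≢0 (picks is) _ T≢0
  ... | (i , js) , p∈ , term≢0 = subst (multiplicity (a ∷ w) e ℕ.≤_)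
          (sym (↭-length (filter-↭ (λ i → ¬? (F i e ≟ 0ℚ)) (∈-picks⁻ {xs = is} p∈)))) bound
    where
    ih = multiplicity-≤ F js w (p*q≢0⇒q≢0 (F i a) (polar F js w) term≢0) e
    bound : multiplicity (a ∷ w) e ℕ.≤ length (filter (λ i → ¬? (F i e ≟ 0ℚ)) (i ∷ js))
    bound with a ≟′ e
    ... | yes refl = subst (λ l → _ ℕ.≤ length l)
            (sym (filter-accept (λ i → ¬? (F i e ≟ 0ℚ)) (p*q≢0⇒p≢0 (F i a) (polar F js w) term≢0)))
            (s≤s ih)
    ... | no _ with F i e ≟ 0ℚ
    ... | yes _ = ih
    ... | no _  = ℕ.m≤n⇒m≤1+n ih

  module _ (es : List A) (unique : Unique es) (complete : ∀ e → e ∈ es) (F : I → A → ℚ)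
           (p : ℕ → A → Fin 3 → ℚ) (cauchy-p : ∀ e i → Cauchy (λ n → p n e i)) where
    open Forms es unique complete F
    open module E (n : ℕ) = Evaluation (p n) hiding (assign)
    -- `assign` is the same for every approximation; fixing index 0 lets all of them share their
    -- assignments.
    open Evaluation (p 0) using (assign)

    cauchy-functional : ∀ K xs {P : ℕ → (A → Fin 3) → ℚ} → (∀ c → Cauchy (λ n → P n c)) →
      ∀ c → Cauchy (λ n → functional n K xs (P n) c)
    cauchy-functional K []       cP c = cP c
    cauchy-functional K (e ∷ xs) cP c = cauchy-∑ choices (λ i →
      cauchy-* (cauchy-weight (cauchy-p e) (K e) i) (cauchy-functional K xs cP (assign c e i)))

    -- Variable by variable, a sum over three choices apart from 0 has such a term. The weight of
    -- that term is a Cauchy sequence, hence bounded, and can be divided off.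
    nonVanishing-functional⁻ : ∀ K xs {P : ℕ → (A → Fin 3) → ℚ} → (∀ c → Cauchy (λ n → P n c)) →
      ∀ c → NonVanishing (λ n → functional n K xs (P n) c) → ∃[ c′ ] NonVanishing (λ n → P n c′)
    nonVanishing-functional⁻ K []       cP c nv = c , nv
    nonVanishing-functional⁻ K (e ∷ xs) {P} cP c nv =
      let w i n = weight (p n e) (K e) i
          f i n = functional n K xs (P n) (assign c e i)
          cw i = cauchy-weight (cauchy-p e) (K e) i
          i , nvᵢ = nonVanishing-∑⁻ choices {λ i n → w i n * f i n}
                      (λ i → cauchy-* (cw i) (cauchy-functional K xs cP (assign c e i))) nv
      in nonVanishing-functional⁻ K xs cP (assign c e i)
           (nonVanishing-*⁻ʳ {w i} {f i} (cw i) nvᵢ)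

    cauchy-value : ∀ {γ : ℕ → I → ℚ} → (∀ i → Cauchy (λ n → γ n i)) →
      ∀ i c → Cauchy (λ n → value n (γ n) i c)
    cauchy-value cγ i c = cauchy-+ (cγ i) (cauchy-∑ es (λ e →
      cauchy-* (cauchy-const (F i e)) (cauchy-p e (c e))))

    -- One `c` serves all approximations: the right side of `functional-∏` is apart from 0 as a
    -- sequence, and apartness passes first to a grid point and then to each factor of the product
    -- there.
    combinatorialNullstellensatz :
      (∀ e i j → i ≢ j → NonVanishing (λ n → p n e i - p n e j)) →
      ∀ (γ : ℕ → I → ℚ) → (∀ i → Cauchy (λ n → γ n i)) →
      ∀ is K → (∀ e → K e ℕ.≤ 2) → length is ℕ.≤ degree K es → coef is K ≢ 0ℚ →
      ∃[ c ] (∀ {i} → i ∈ is → NonVanishing (λ n → value n (γ n) i c))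
    combinatorialNullstellensatz apart γ cγ is K K≤2 len≤ coef≢0 =
      -- The initial assignment `λ _ → zero` is overwritten at every variable, since `es` is
      -- complete.
      let c , nv = nonVanishing-functional⁻ K es
            (λ c → cauchy-∏ is (λ i → cauchy-value cγ i c)) (λ _ → zero)
            (nonVanishing-cong (λ n → sym (functional-∏ n (γ n) is K K≤2 len≤ (λ _ → zero)))
              (nonVanishing-* (nonVanishing-∏ es (λ e → nonVanishing-scale (apart e) (K≤2 e)))
                              (nonVanishing-const coef≢0)))
      in c , nonVanishing-∏⁻ (λ i → cauchy-value cγ i c) nv

-- Lists and the enumeration of edges.

-- The pigeonhole principle with two holes. `side` takes the membership proof because the side of an
-- edge will be extracted from that proof.
length≤2 : ∀ {xs : List A} → Unique xs → (side : ∀ {x} → x ∈ xs → Bool) →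
  (∀ {x y} (x∈ : x ∈ xs) (y∈ : y ∈ xs) → side x∈ ≡ side y∈ → x ≡ y) → length xs ℕ.≤ 2
length≤2 {xs = []}        u side inj = z≤n
length≤2 {xs = _ ∷ []}    u side inj = s≤s z≤n
length≤2 {xs = _ ∷ _ ∷ []} u side inj = s≤s (s≤s z≤n)
length≤2 {xs = _ ∷ _ ∷ _ ∷ _} ((x≢y ∷ x≢z ∷ _) ∷ (y≢z ∷ _) ∷ _) side inj =
  ⊥-elim (pigeonhole (side x∈) (side y∈) (side z∈)
    (x≢y ∘ inj x∈ y∈) (x≢z ∘ inj x∈ z∈) (y≢z ∘ inj y∈ z∈))
  where
  x∈ = here refl
  y∈ = there (here refl)
  z∈ = there (there (here refl))
  pigeonhole : ∀ (a b c : Bool) → a ≢ b → a ≢ c → ¬ b ≢ c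
  pigeonhole false false _     a≢b _   _   = a≢b refl
  pigeonhole false true  false _   a≢c _   = a≢c refl
  pigeonhole false true  true  _   _   b≢c = b≢c refl
  pigeonhole true  true  _     a≢b _   _   = a≢b refl
  pigeonhole true  false true  _   a≢c _   = a≢c refl
  pigeonhole true  false false _   _   b≢c = b≢c refl

mapMaybe-unique : ∀ (f : A → Maybe B) → (∀ {x y z} → f x ≡ just z → f y ≡ just z → x ≡ y) →
  ∀ {xs} → Unique xs → Unique (mapMaybe f xs)
mapMaybe-unique f inj {[]}     []       = []
mapMaybe-unique f inj {x ∷ xs} (x∉ ∷ u) with f x in eq
... | nothing = mapMaybe-unique f inj u
... | just z  = fresh x∉ ∷ mapMaybe-unique f inj u
  where
  fresh : ∀ {ys} → All (x ≢_) ys → All (z ≢_) (mapMaybe f ys)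
  fresh []                       = []
  fresh {y ∷ ys} (x≢y ∷ x∉) with f y in eq′
  ... | nothing = fresh x∉
  ... | just z′ = (λ {refl → x≢y (inj eq eq′)}) ∷ fresh x∉

mapMaybe-∈⁺ : ∀ (f : A → Maybe B) {xs x y} → x ∈ xs → f x ≡ just y → y ∈ mapMaybe f xs
mapMaybe-∈⁺ f {xs} x∈ eq = Any.mapMaybe⁺ f xs
  (lose (subst (_∈ map f xs) eq (∈-map⁺ f x∈)) (Maybe.just refl))

mapMaybe-∈⁻ : ∀ (f : A → Maybe B) xs {y} → y ∈ mapMaybe f xs → ∃[ x ] f x ≡ just y
mapMaybe-∈⁻ f (x ∷ xs) y∈ with f x in eq
... | nothing = mapMaybe-∈⁻ f xs y∈
mapMaybe-∈⁻ f (x ∷ xs) (here refl) | just _ = x , eq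
mapMaybe-∈⁻ f (x ∷ xs) (there y∈)  | just _ = mapMaybe-∈⁻ f xs y∈

module _ {n : ℕ} {G : SimpleGraph n} where

  edge-≡ : ∀ {e f : Edge G} → lo e ≡ lo f → hi e ≡ hi f → e ≡ f
  edge-≡ {mkEdge a b p q} {mkEdge _ _ p′ q′} refl refl =
    cong₂ (mkEdge a b) (Fin.<-irrelevant p p′) (T-irrelevant q q′)

  _≟ᴱ_ : DecidableEquality (Edge G)
  e ≟ᴱ f = map′ (λ (p , q) → edge-≡ p q) (λ e≡f → cong lo e≡f , cong hi e≡f)
    ((lo e Fin.≟ lo f) ×-dec (hi e Fin.≟ hi f))

  edge?-complete : ∀ e → edge? G (lo e) (hi e) ≡ just e
  edge?-complete e with lo e Fin.<? hi e | T? (adj G (lo e) (hi e))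
  ... | yes _   | yes _ = cong just (edge-≡ refl refl)
  ... | yes _   | no ¬t = ⊥-elim (¬t (joined e))
  ... | no lo≮hi | _    = ⊥-elim (lo≮hi (lo<hi e))

  edge?-sound : ∀ i j {e} → edge? G i j ≡ just e → i ≡ lo e × j ≡ hi e
  edge?-sound i j eq with i Fin.<? j | T? (adj G i j)
  edge?-sound i j refl | yes _ | yes _ = refl , refl
  edge?-sound i j ()   | yes _ | no _
  edge?-sound i j ()   | no _  | _

  edges-complete : ∀ e → e ∈ edges G
  edges-complete e = ∈-concatMap⁺ (λ i → mapMaybe (edge? G i) (allFin n))
    (lose (∈-allFin (lo e)) (mapMaybe-∈⁺ (edge? G (lo e)) (∈-allFin (hi e)) (edge?-complete e)))

  -- An inner list fixes the lower end, so different inner lists are disjoint, and within one list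
  -- the upper end determines the edge.
  edges-unique : Unique (edges G)
  edges-unique = Unique.concat⁺
    (All.map⁺ (All.universal (λ i → mapMaybe-unique (edge? G i)
      (λ {j} {j′} p q → trans (proj₂ (edge?-sound i j p)) (sym (proj₂ (edge?-sound i j′ q))))
      (Unique.allFin⁺ n)) (allFin n)))
    (AllPairs.map⁺ (AllPairs.map disjoint (Unique.allFin⁺ n)))
    where
    disjoint : ∀ {i j} → i ≢ j →
      Disjoint (mapMaybe (edge? G i) (allFin n)) (mapMaybe (edge? G j) (allFin n))
    disjoint {i} {j} i≢j (p , q) =
      let k , eq  = mapMaybe-∈⁻ (edge? G i) (allFin n) p
          l , eq′ = mapMaybe-∈⁻ (edge? G j) (allFin n) q
      in i≢j (trans (proj₁ (edge?-sound i k eq)) (sym (proj₁ (edge?-sound j l eq′))))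

  joinEdge : ∀ i j → i ≢ j → T (adj G i j) →
    Σ[ e ∈ Edge G ] ((lo e ≡ i × hi e ≡ j) ⊎ (lo e ≡ j × hi e ≡ i))
  joinEdge i j i≢j t with Fin.<-cmp i j
  ... | tri< i<j _ _ = mkEdge i j i<j t , inj₁ (refl , refl)
  ... | tri≈ _ i≡j _ = ⊥-elim (i≢j i≡j)
  ... | tri> _ _ j<i = mkEdge j i j<i (subst T (adj-sym G i j) t) , inj₂ (refl , refl)

-- Midpoints modulo an odd number

infix 4 _≡_[mod_]

-- Multiples of `k` are added on both sides, which avoids truncated subtraction.
_≡_[mod_] : ℕ → ℕ → ℕ → Set
a ≡ b [mod k ] = ∃[ i ] ∃[ j ] (a ℕ.+ i ℕ.* k ≡ b ℕ.+ j ℕ.* k)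

mod-sym-trans : ∀ {a b c k} → c ≡ a [mod k ] → c ≡ b [mod k ] → a ≡ b [mod k ]
mod-sym-trans {a} {b} {c} {k} (i , j , eq) (i′ , j′ , eq′) = j ℕ.+ i′ , j′ ℕ.+ i , (begin
  a ℕ.+ (j ℕ.+ i′) ℕ.* k             ≡⟨ shuffle a j i′ k ⟩
  (a ℕ.+ j ℕ.* k) ℕ.+ i′ ℕ.* k       ≡⟨ cong (ℕ._+ i′ ℕ.* k) eq ⟨
  (c ℕ.+ i ℕ.* k) ℕ.+ i′ ℕ.* k       ≡⟨ shuffle c i i′ k ⟨
  c ℕ.+ (i ℕ.+ i′) ℕ.* k             ≡⟨ cong (λ m → c ℕ.+ m ℕ.* k) (ℕ.+-comm i i′) ⟩
  c ℕ.+ (i′ ℕ.+ i) ℕ.* k             ≡⟨ shuffle c i′ i k ⟩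
  (c ℕ.+ i′ ℕ.* k) ℕ.+ i ℕ.* k       ≡⟨ cong (ℕ._+ i ℕ.* k) eq′ ⟩
  (b ℕ.+ j′ ℕ.* k) ℕ.+ i ℕ.* k       ≡⟨ shuffle b j′ i k ⟨
  b ℕ.+ (j′ ℕ.+ i) ℕ.* k             ∎)
  where
  open ≡-Reasoning
  shuffle : ∀ a i j k → a ℕ.+ (i ℕ.+ j) ℕ.* k ≡ (a ℕ.+ i ℕ.* k) ℕ.+ j ℕ.* k
  shuffle = solve 4 (λ a i j k → a :+ (i :+ j) :* k := (a :+ i :* k) :+ j :* k) refl
    where open ℕ.+-*-Solver

mod-cancelˡ : ∀ a {b c k} → b ℕ.< k → c ℕ.< k → a ℕ.+ b ≡ a ℕ.+ c [mod k ] → b ≡ c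
mod-cancelˡ a {b} {c} {suc k} b<k c<k (i , j , eq) = begin
  b                        ≡⟨ m<n⇒m%n≡m b<k ⟨
  b % suc k                ≡⟨ [m+kn]%n≡m%n b i (suc k) ⟨
  (b ℕ.+ i ℕ.* suc k) % suc k  ≡⟨ cong (_% suc k) (ℕ.+-cancelˡ-≡ a _ _
      (trans (sym (ℕ.+-assoc a b _)) (trans eq (ℕ.+-assoc a c _)))) ⟩
  (c ℕ.+ j ℕ.* suc k) % suc k  ≡⟨ [m+kn]%n≡m%n c j (suc k) ⟩
  c % suc k                ≡⟨ m<n⇒m%n≡m c<k ⟩
  c                        ∎
  where open ≡-Reasoning

-- If k = 2q + 1 then q + 1 is an inverse of 2 modulo k.
midpoint : ∀ {k} → k % 2 ≡ 1 → ∀ m → ∃[ z ] (z ℕ.< k × (z ℕ.+ z) ≡ m [mod k ])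
midpoint {zero}      ()
midpoint {k@(suc _)} odd m = x % k , m%n<n x k , (x / k) ℕ.+ (x / k) , m , (begin
  (z ℕ.+ z) ℕ.+ (x / k ℕ.+ x / k) ℕ.* k         ≡⟨ double z (x / k) k ⟩
  (z ℕ.+ x / k ℕ.* k) ℕ.+ (z ℕ.+ x / k ℕ.* k)   ≡⟨ cong (λ y → y ℕ.+ y) (m≡m%n+[m/n]*n x k) ⟨
  x ℕ.+ x                                       ≡⟨ expand m q ⟩
  m ℕ.+ m ℕ.* (1 ℕ.+ q ℕ.* 2)                   ≡⟨ cong (λ y → m ℕ.+ m ℕ.* y)
    (sym (trans (m≡m%n+[m/n]*n k 2) (cong (ℕ._+ q ℕ.* 2) odd))) ⟩
  m ℕ.+ m ℕ.* k                                 ∎)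
  where
  open ≡-Reasoning
  q = k / 2
  x = m ℕ.* suc q
  z = x % k
  double : ∀ z d k → (z ℕ.+ z) ℕ.+ (d ℕ.+ d) ℕ.* k ≡ (z ℕ.+ d ℕ.* k) ℕ.+ (z ℕ.+ d ℕ.* k)
  double = solve 3 (λ z d k → (z :+ z) :+ (d :+ d) :* k := (z :+ d :* k) :+ (z :+ d :* k)) refl
    where open ℕ.+-*-Solver
  expand : ∀ m q → m ℕ.* suc q ℕ.+ m ℕ.* suc q ≡ m ℕ.+ m ℕ.* (1 ℕ.+ q ℕ.* 2)
  expand = solve 2 (λ m q → m :* (con 1 :+ q) :+ m :* (con 1 :+ q) :=
    m :+ m :* (con 1 :+ q :* con 2)) refl
    where open ℕ.+-*-Solver

-- The number of elements of `S` before `x`. On members it is a bijection onto the residues modulo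
-- the order of `S`, so that midpoints can be taken inside a clique.
rank : ∀ {n} → Subset n → Fin n → ℕ
rank (_       ∷ S) zero    = 0
rank (inside  ∷ S) (suc x) = suc (rank S x)
rank (outside ∷ S) (suc x) = rank S x

rank<∣S∣ : ∀ {n} {S : Subset n} {x} → x ∈ₛ S → rank S x ℕ.< Subset.∣ S ∣
rank<∣S∣ {S = inside  ∷ S} here       = s≤s z≤n
rank<∣S∣ {S = inside  ∷ S} (there x∈) = s≤s (rank<∣S∣ x∈)
rank<∣S∣ {S = outside ∷ S} (there x∈) = rank<∣S∣ x∈

rank-injective : ∀ {n} {S : Subset n} {x y} → x ∈ₛ S → y ∈ₛ S → rank S x ≡ rank S y → x ≡ y
rank-injective {S = _ ∷ S} here       here       eq = refl
rank-injective {S = inside  ∷ S} (there x∈) (there y∈) eq =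
  cong suc (rank-injective x∈ y∈ (ℕ.suc-injective eq))
rank-injective {S = outside ∷ S} (there x∈) (there y∈) eq = cong suc (rank-injective x∈ y∈ eq)

rank-surjective : ∀ {n} (S : Subset n) {k} → k ℕ.< Subset.∣ S ∣ → ∃[ x ] (x ∈ₛ S × rank S x ≡ k)
rank-surjective (inside  ∷ S) {zero}  _   = zero , here , refl
rank-surjective (inside  ∷ S) {suc k} k<  =
  let x , x∈ , eq = rank-surjective S (ℕ.s≤s⁻¹ k<) in suc x , there x∈ , cong suc eq
rank-surjective (outside ∷ S) k< =
  let x , x∈ , eq = rank-surjective S k< in suc x , there x∈ , eq

Midpoint : ∀ {n} → Subset n → (x y z : Fin n) → Set
Midpoint S x y z = rank S z ℕ.+ rank S z ≡ rank S x ℕ.+ rank S y [mod Subset.∣ S ∣ ]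

midpoint-comm : ∀ {n} (S : Subset n) {x y z} → Midpoint S x y z → Midpoint S y x z
midpoint-comm S {x} {y} (i , j , eq) =
  i , j , trans eq (cong (ℕ._+ j ℕ.* Subset.∣ S ∣) (ℕ.+-comm (rank S x) (rank S y)))

-- Twice the rank of the midpoint minus that of `x` fixes the other rank modulo the order of `S`,
-- and ranks of members lie below that order.
midpoint-cancel : ∀ {n} {S : Subset n} {x y y′ z} → y ∈ₛ S → y′ ∈ₛ S →
  Midpoint S x y z → Midpoint S x y′ z → y ≡ y′
midpoint-cancel {S = S} {x} y∈ y′∈ mid mid′ = rank-injective y∈ y′∈
  (mod-cancelˡ (rank S x) (rank<∣S∣ y∈) (rank<∣S∣ y′∈) (mod-sym-trans mid mid′))

midpoint-self : ∀ {n} (S : Subset n) x → Midpoint S x x x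
midpoint-self S x = 0 , 0 , refl

midpoint-exists : ∀ {n} (S : Subset n) → Subset.∣ S ∣ % 2 ≡ 1 → ∀ x y →
  ∃[ z ] (z ∈ₛ S × Midpoint S x y z)
midpoint-exists S odd x y =
  let m , m< , mid = midpoint odd (rank S x ℕ.+ rank S y)
      z , z∈ , eq  = rank-surjective S m<
  in z , z∈ , subst (λ k → (k ℕ.+ k) ≡ rank S x ℕ.+ rank S y [mod Subset.∣ S ∣ ]) (sym eq) mid

-- Kronecker deltas.

δ : DecidableEquality A → A → A → ℚ
δ _≟′_ x y = if does (x ≟′ y) then 1ℚ else 0ℚ

∑-δ : ∀ (_≟′_ : DecidableEquality A) {xs x} (f : A → ℚ) → Unique xs → x ∈ xs →
  ∑ xs (λ y → δ _≟′_ x y * f y) ≡ f x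
∑-δ _≟′_ {xs} {x} f u x∈ = trans (∑-single u x∈ off) on
  where
  off : ∀ y → x ≢ y → δ _≟′_ x y * f y ≡ 0ℚ
  off y x≢y with x ≟′ y
  ... | yes x≡y = ⊥-elim (x≢y x≡y)
  ... | no _    = *-zeroˡ (f y)
  on : δ _≟′_ x x * f x ≡ f x
  on with x ≟′ x
  ... | yes _  = *-identityˡ (f x)
  ... | no x≢x = ⊥-elim (x≢x refl)

∑-δ-δ : ∀ (_≟′_ : DecidableEquality A) {xs x x′} (f : A → ℚ) → Unique xs → x ∈ xs → x′ ∈ xs →
  ∑ xs (λ y → (δ _≟′_ x y - δ _≟′_ x′ y) * f y) ≡ f x - f x′
∑-δ-δ _≟′_ {xs} {x} {x′} f u x∈ x′∈ = begin
  ∑ xs (λ y → (δ _≟′_ x y - δ _≟′_ x′ y) * f y)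
    ≡⟨ ∑-cong xs (λ y → split (δ _≟′_ x y) (δ _≟′_ x′ y) (f y)) ⟩
  ∑ xs (λ y → δ _≟′_ x y * f y + (- 1ℚ) * (δ _≟′_ x′ y * f y))
    ≡⟨ ∑-+ xs (λ y → δ _≟′_ x y * f y) _ ⟩
  ∑ xs (λ y → δ _≟′_ x y * f y) + ∑ xs (λ y → (- 1ℚ) * (δ _≟′_ x′ y * f y))
    ≡⟨ cong₂ _+_ (∑-δ _≟′_ f u x∈) (trans (∑-*ˡ (- 1ℚ) xs (λ y → δ _≟′_ x′ y * f y))
         (cong ((- 1ℚ) *_) (∑-δ _≟′_ f u x′∈))) ⟩
  f x + (- 1ℚ) * f x′
    ≡⟨ join (f x) (f x′) ⟩
  f x - f x′ ∎
  where
  open ≡-Reasoning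
  open +-*-Solver
  split : ∀ a b c → (a - b) * c ≡ a * c + (- 1ℚ) * (b * c)
  split = solve 3 (λ a b c → (a :- b) :* c := a :* c :+ con (- 1ℚ) :* (b :* c)) refl
  join : ∀ a b → a + (- 1ℚ) * b ≡ a - b
  join = solve 2 (λ a b → a :+ con (- 1ℚ) :* b := a :- b) refl

δ-δ≢0 : ∀ (_≟′_ : DecidableEquality A) x x′ y → δ _≟′_ x y - δ _≟′_ x′ y ≢ 0ℚ → x ≡ y ⊎ x′ ≡ y
δ-δ≢0 _≟′_ x x′ y ≢0 with x ≟′ y | x′ ≟′ y
... | yes x≡y | _        = inj₁ x≡y
... | no _    | yes x′≡y = inj₂ x′≡y
... | no _    | no _     = ⊥-elim (≢0 refl)

fromℕ-nonNeg : ∀ m → 0ℚ ≤ fromℕ m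
fromℕ-nonNeg zero    = ≤-refl
fromℕ-nonNeg (suc m) = +-mono-≤ (<⇒≤ (positive⁻¹ 1ℚ)) (fromℕ-nonNeg m)

fromℕ-mono-< : ∀ {m n} → m ℕ.< n → fromℕ m < fromℕ n
fromℕ-mono-< {zero}  {suc n} _   = +-mono-<-≤ (positive⁻¹ 1ℚ) (fromℕ-nonNeg n)
fromℕ-mono-< {suc m} {suc n} m<n = +-monoʳ-< 1ℚ (fromℕ-mono-< (ℕ.s≤s⁻¹ m<n))

p<q⇒0<q-p : ∀ {p q} → p < q → 0ℚ < q - p
p<q⇒0<q-p {p} {q} p<q = subst (_< q - p) (+-inverseʳ p) (+-monoˡ-< (- p) p<q)

-- Vertex sums as linear forms in the edge weights.

module _ {n : ℕ} (G : SimpleGraph n) where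

  V : List (Fin n)
  V = allFin n

  -- The form v_e in the vertex variables.
  difference : Edge G → Fin n → ℚ
  difference e i = δ Fin._≟_ (hi e) i - δ Fin._≟_ (lo e) i

  -- An entry of the incidence matrix, 0 or 1 because the ends of an edge differ. As a sum of deltas
  -- it lets a common end of two edges cancel by linear algebra.
  incidence : Fin n → Edge G → ℚ
  incidence i e = δ Fin._≟_ (lo e) i + δ Fin._≟_ (hi e) i

  -- The linear part of vertexSum (hi e) − vertexSum (lo e) as a form in the edge weights.
  sumDifference : Edge G → Edge G → ℚ
  sumDifference e g = incidence (hi e) g - incidence (lo e) g

  ∑-difference : ∀ e f → ⟨ V ⟩ difference e ∙ f ≡ f (hi e) - f (lo e)
  ∑-difference e f =
    ∑-δ-δ Fin._≟_ f (Unique.allFin⁺ n) (∈-allFin (hi e)) (∈-allFin (lo e))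

  -- As edges are oriented upwards, the point X_i = i makes all the forms v_e positive, as
  -- `0<polarProduct` requires.
  0<difference-toℕ : ∀ e → 0ℚ < ⟨ V ⟩ difference e ∙ (fromℕ ∘ toℕ)
  0<difference-toℕ e =
    subst (0ℚ <_) (sym (∑-difference e (fromℕ ∘ toℕ))) (p<q⇒0<q-p (fromℕ-mono-< (lo<hi e)))

  ∑-filter-incident : ∀ i (es : List (Edge G)) f →
    ∑ (filter (incident? G i) es) f ≡ ∑ es (λ e → incidence i e * f e)
  ∑-filter-incident i []       f = refl
  -- `incident?` compares `i` with the ends and `δ` compares the ends with `i`, hence four
  -- decisions.
  ∑-filter-incident i (e ∷ es) f with i Fin.≟ lo e | i Fin.≟ hi e | lo e Fin.≟ i | hi e Fin.≟ i
  ... | yes p | yes q | _     | _     = ⊥-elim (Fin.<⇒≢ (lo<hi e) (trans (sym p) q))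
  ... | yes p | no ¬q | no ¬p | _     = ⊥-elim (¬p (sym p))
  ... | yes p | no ¬q | yes _ | yes q = ⊥-elim (¬q (sym q))
  ... | yes p | no ¬q | yes _ | no _  =
    cong₂ _+_ (sym (*-identityˡ (f e))) (∑-filter-incident i es f)
  ... | no ¬p | yes q | yes p | _     = ⊥-elim (¬p (sym p))
  ... | no ¬p | yes q | no _  | no ¬q = ⊥-elim (¬q (sym q))
  ... | no ¬p | yes q | no _  | yes _ =
    cong₂ _+_ (sym (*-identityˡ (f e))) (∑-filter-incident i es f)
  ... | no ¬p | no ¬q | yes p | _     = ⊥-elim (¬p (sym p))
  ... | no ¬p | no ¬q | no _  | yes q = ⊥-elim (¬q (sym q))
  ... | no ¬p | no ¬q | no _  | no _  =
    trans (∑-filter-incident i es f) (sym (trans (cong (_+ _) (*-zeroˡ (f e))) (+-identityˡ _)))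

  seq-vertexSum : ∀ (φ : TotalWeighting G) i k → seq (vertexSum G φ i) k ≡
    ∑ (edges G) (λ e → incidence i e * seq (φ (inj₂ e)) k) + seq (φ (inj₁ i)) k
  seq-vertexSum φ i k = cong (_+ seq (φ (inj₁ i)) k)
    (trans (seq-sumℝ (incidentEdges G i)) (∑-filter-incident i (edges G) _))
    where
    seq-sumℝ : ∀ es → seq (sumℝ (map (λ e → φ (inj₂ e)) es)) k ≡ ∑ es (λ e → seq (φ (inj₂ e)) k)
    seq-sumℝ []       = refl
    seq-sumℝ (e ∷ es) = cong (seq (φ (inj₂ e)) k +_) (seq-sumℝ es)

  -- Puts the difference of two vertex sums into the shape of `value`: a constant from the vertex
  -- weights plus a linear form in the edge weights.
  seq-vertexSum-difference : ∀ (φ : TotalWeighting G) e k →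
    (seq (φ (inj₁ (hi e))) k - seq (φ (inj₁ (lo e))) k) +
      ∑ (edges G) (λ g → sumDifference e g * seq (φ (inj₂ g)) k) ≡
    seq (vertexSum G φ (hi e)) k - seq (vertexSum G φ (lo e)) k
  seq-vertexSum-difference φ e k = begin
    (b - a) + ∑ (edges G) (λ g → sumDifference e g * x g)
      ≡⟨ cong ((b - a) +_) (trans (∑-cong (edges G) (λ g →
           split (incidence (hi e) g) (incidence (lo e) g) (x g)))
         (trans (∑-+ (edges G) (λ g → incidence (hi e) g * x g) _)
                (cong (sʰ +_) (∑-*ˡ (- 1ℚ) (edges G) (λ g → incidence (lo e) g * x g))))) ⟩
    (b - a) + (sʰ + (- 1ℚ) * sˡ)
      ≡⟨ regroup b a sʰ sˡ ⟩
    (sʰ + b) - (sˡ + a)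
      ≡⟨ cong₂ _-_ (seq-vertexSum φ (hi e) k) (seq-vertexSum φ (lo e) k) ⟨
    seq (vertexSum G φ (hi e)) k - seq (vertexSum G φ (lo e)) k ∎
    where
    open ≡-Reasoning
    open +-*-Solver
    x : Edge G → ℚ
    x g = seq (φ (inj₂ g)) k
    a = seq (φ (inj₁ (lo e))) k
    b = seq (φ (inj₁ (hi e))) k
    sˡ = ∑ (edges G) (λ g → incidence (lo e) g * x g)
    sʰ = ∑ (edges G) (λ g → incidence (hi e) g * x g)
    split : ∀ a b c → (a - b) * c ≡ a * c + (- 1ℚ) * (b * c)
    split = solve 3 (λ a b c → (a :- b) :* c := a :* c :+ con (- 1ℚ) :* (b :* c)) refl
    regroup : ∀ b a t s → (b - a) + (t + (- 1ℚ) * s) ≡ (t + b) - (s + a)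
    regroup = solve 4 (λ b a t s → (b :- a) :+ (t :+ con (- 1ℚ) :* s) := (t :+ b) :- (s :+ a)) refl

  -- Apexes and side edges in the cliques.

  module _ (D : OddCliqueDecomposition G) where
    open OddCliqueDecomposition D

    cliqueIndex : Edge G → Fin size
    cliqueIndex e = proj₁ (partition e)

    cliqueOf : Edge G → Subset n
    cliqueOf e = clique (cliqueIndex e)

    lo∈ : ∀ e → lo e ∈ₛ cliqueOf e
    lo∈ e = proj₁ (proj₁ (proj₂ (partition e)))

    hi∈ : ∀ e → hi e ∈ₛ cliqueOf e
    hi∈ e = proj₂ (proj₁ (proj₂ (partition e)))

    cliqueOf-unique : ∀ e {a} → lo e ∈ₛ clique a → hi e ∈ₛ clique a → clique a ≡ cliqueOf e
    cliqueOf-unique e lo∈a hi∈a = cong clique (sym (proj₂ (proj₂ (partition e)) (lo∈a , hi∈a)))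

    private
      apex-data : ∀ e → ∃[ z ] (z ∈ₛ cliqueOf e × Midpoint (cliqueOf e) (lo e) (hi e) z)
      apex-data e = midpoint-exists (cliqueOf e) (oddOrder (cliqueIndex e)) (lo e) (hi e)

    apex : Edge G → Fin n
    apex e = proj₁ (apex-data e)

    apex∈ : ∀ e → apex e ∈ₛ cliqueOf e
    apex∈ e = proj₁ (proj₂ (apex-data e))

    apex-midpoint : ∀ e → Midpoint (cliqueOf e) (lo e) (hi e) (apex e)
    apex-midpoint e = proj₂ (proj₂ (apex-data e))

    -- A vertex is the midpoint of itself with itself, so an apex equal to an end would make the two
    -- ends equal by `midpoint-cancel`.
    lo≢apex : ∀ e → lo e ≢ apex e
    lo≢apex e lo≡z = Fin.<⇒≢ (lo<hi e) (midpoint-cancel {x = lo e} (lo∈ e) (hi∈ e)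
      (midpoint-self (cliqueOf e) (lo e))
      (subst (Midpoint (cliqueOf e) (lo e) (hi e)) (sym lo≡z) (apex-midpoint e)))

    hi≢apex : ∀ e → hi e ≢ apex e
    hi≢apex e hi≡z = Fin.<⇒≢ (lo<hi e) (sym (midpoint-cancel {x = hi e} (hi∈ e) (lo∈ e)
      (midpoint-self (cliqueOf e) (hi e))
      (subst (Midpoint (cliqueOf e) (hi e) (lo e)) (sym hi≡z)
        (midpoint-comm (cliqueOf e) (apex-midpoint e)))))

    Joins : Fin n → Fin n → Edge G → Set
    Joins i j e = (lo e ≡ i × hi e ≡ j) ⊎ (lo e ≡ j × hi e ≡ i)

    private
      loSide-data : ∀ e → Σ[ g ∈ Edge G ] Joins (lo e) (apex e) g
      loSide-data e = joinEdge (lo e) (apex e) (lo≢apex e)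
        (isClique (cliqueIndex e) (lo e) (apex e) (lo∈ e) (apex∈ e) (lo≢apex e))

      hiSide-data : ∀ e → Σ[ g ∈ Edge G ] Joins (hi e) (apex e) g
      hiSide-data e = joinEdge (hi e) (apex e) (hi≢apex e)
        (isClique (cliqueIndex e) (hi e) (apex e) (hi∈ e) (apex∈ e) (hi≢apex e))

    loSide hiSide : Edge G → Edge G
    loSide e = proj₁ (loSide-data e)
    hiSide e = proj₁ (hiSide-data e)

    -- The form m_e: the weight of the edge from the upper end to the apex minus that of the edge
    -- from the lower end to the apex.
    sideDifference : Edge G → Edge G → ℚ
    sideDifference e g = δ _≟ᴱ_ (hiSide e) g - δ _≟ᴱ_ (loSide e) g

    incidence-joins : ∀ {i j e} → Joins i j e → ∀ k →
      incidence k e ≡ δ Fin._≟_ i k + δ Fin._≟_ j k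
    incidence-joins (inj₁ (refl , refl)) k = refl
    incidence-joins {e = e} (inj₂ (refl , refl)) k = +-comm (δ Fin._≟_ (lo e) k) _

    -- The apex is an end of both sides and cancels.
    incidence-sides : ∀ i e → incidence i (hiSide e) - incidence i (loSide e) ≡ difference e i
    incidence-sides i e = trans
      (cong₂ _-_ (incidence-joins {e = hiSide e} (proj₂ (hiSide-data e)) i)
                 (incidence-joins {e = loSide e} (proj₂ (loSide-data e)) i))
      (cancel (δ Fin._≟_ (hi e) i) (δ Fin._≟_ (apex e) i) (δ Fin._≟_ (lo e) i))
      where
      open +-*-Solver
      cancel : ∀ a b c → (a + b) - (c + b) ≡ a - c
      cancel = solve 3 (λ a b c → (a :+ b) :- (c :+ b) := a :- c) refl

    -- The deltas in m_f evaluate l_e at the two sides of `f`. Exchanging the order of the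
    -- differences and applying `incidence-sides` leaves v_f at the two ends of `e`.
    pairing : ∀ e f →
      ⟨ V ⟩ difference e ∙ difference f ≡ ⟨ edges G ⟩ sumDifference e ∙ sideDifference f
    pairing e f = begin
      ⟨ V ⟩ difference e ∙ difference f
        ≡⟨ ∑-difference e (difference f) ⟩
      difference f (hi e) - difference f (lo e)
        ≡⟨ cong₂ _-_ (incidence-sides (hi e) f) (incidence-sides (lo e) f) ⟨
      (incidence (hi e) (hiSide f) - incidence (hi e) (loSide f)) -
      (incidence (lo e) (hiSide f) - incidence (lo e) (loSide f))
        ≡⟨ exchange (incidence (hi e) (hiSide f)) (incidence (hi e) (loSide f))
                    (incidence (lo e) (hiSide f)) (incidence (lo e) (loSide f)) ⟩
      sumDifference e (hiSide f) - sumDifference e (loSide f)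
        ≡⟨ ∑-δ-δ _≟ᴱ_ (sumDifference e) edges-unique
             (edges-complete (hiSide f)) (edges-complete (loSide f)) ⟨
      ∑ (edges G) (λ g → sideDifference f g * sumDifference e g)
        ≡⟨ ∑-cong (edges G) (λ g → *-comm (sideDifference f g) (sumDifference e g)) ⟩
      ⟨ edges G ⟩ sumDifference e ∙ sideDifference f ∎
      where
      open ≡-Reasoning
      open +-*-Solver
      exchange : ∀ a b c d → (a - b) - (c - d) ≡ (a - c) - (b - d)
      exchange = solve 4 (λ a b c d → (a :- b) :- (c :- d) := (a :- c) :- (b :- d)) refl

    -- f has the end p, its apex is z, and p and z are the ends of g.
    record Corner (g f : Edge G) (p z : Fin n) : Set where
      field
        q    : Fin n
        q∈   : q ∈ₛ cliqueOf g
        mid  : Midpoint (cliqueOf g) p q z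
        ends : Joins p q f

    -- The end `p` and the midpoint `z` determine the other end of the edge by `midpoint-cancel`.
    corner-unique : ∀ {g f f′ p z} → Corner g f p z → Corner g f′ p z → f ≡ f′
    corner-unique {f = f} {f′} {p} c c′ = same (Corner.ends c) (Corner.ends c′)
      where
      q≡q′ = midpoint-cancel {x = p} (Corner.q∈ c) (Corner.q∈ c′) (Corner.mid c) (Corner.mid c′)
      same : Joins p (Corner.q c) f → Joins p (Corner.q c′) f′ → f ≡ f′
      same (inj₁ (a , b)) (inj₁ (a′ , b′)) =
        edge-≡ (trans a (sym a′)) (trans b (trans q≡q′ (sym b′)))
      same (inj₂ (a , b)) (inj₂ (a′ , b′)) =
        edge-≡ (trans a (trans q≡q′ (sym a′))) (trans b (sym b′))
      same (inj₁ (a , b)) (inj₂ (a′ , b′)) = ⊥-elim (Fin.<-asym (lo<hi f)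
        (subst₂ Fin._<_ (trans a′ (sym (trans b q≡q′))) (trans b′ (sym a)) (lo<hi f′)))
      same (inj₂ (a , b)) (inj₁ (a′ , b′)) = ⊥-elim (Fin.<-asym (lo<hi f)
        (subst₂ Fin._<_ (trans a′ (sym b)) (trans b′ (sym (trans a q≡q′))) (lo<hi f′)))

    -- Both ends of the side `g` lie in the clique of `f`, so the two edges have the same clique,
    -- and the midpoint relation of `f` can be read in the clique of `g`.
    corner : ∀ {g f p q} → q ∈ₛ cliqueOf f → p ∈ₛ cliqueOf f →
      Midpoint (cliqueOf f) p q (apex f) → Joins p q f → Joins p (apex f) g →
      Corner g f (lo g) (hi g) ⊎ Corner g f (hi g) (lo g)
    corner {g} {f} {q = q} q∈ p∈ mid ends (inj₁ (refl , hi≡)) = inj₁ (record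
      { q = q
      ; q∈ = subst (q ∈ₛ_) S≡ q∈
      ; mid = subst₂ (λ S z → Midpoint S (lo g) q z) S≡ (sym hi≡) mid
      ; ends = ends })
      where S≡ = cliqueOf-unique g p∈ (subst (_∈ₛ cliqueOf f) (sym hi≡) (apex∈ f))
    corner {g} {f} {q = q} q∈ p∈ mid ends (inj₂ (lo≡ , refl)) = inj₂ (record
      { q = q
      ; q∈ = subst (q ∈ₛ_) S≡ q∈
      ; mid = subst₂ (λ S z → Midpoint S (hi g) q z) S≡ (sym lo≡) mid
      ; ends = ends })
      where S≡ = cliqueOf-unique g (subst (_∈ₛ cliqueOf f) (sym lo≡) (apex∈ f)) p∈

    sideDifference≢0 : ∀ {f g} → sideDifference f g ≢ 0ℚ →
      Corner g f (lo g) (hi g) ⊎ Corner g f (hi g) (lo g)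
    sideDifference≢0 {f} {g} ≢0 = Sum.[
        (λ eq → corner {g} {f} (lo∈ f) (hi∈ f) (midpoint-comm (cliqueOf f) (apex-midpoint f))
          (inj₂ (refl , refl)) (subst (Joins (hi f) (apex f)) eq (proj₂ (hiSide-data f))))
      , (λ eq → corner {g} {f} (hi∈ f) (lo∈ f) (apex-midpoint f)
          (inj₁ (refl , refl)) (subst (Joins (lo f) (apex f)) eq (proj₂ (loSide-data f))))
      ]′ (δ-δ≢0 _≟ᴱ_ (hiSide f) (loSide f) g ≢0)

    -- An edge that has `g` as a side is determined by which of the two ends of `g` is its apex.
    sideDifference-sparse : ∀ g →
      length (filter (λ f → ¬? (sideDifference f g ≟ 0ℚ)) (edges G)) ℕ.≤ 2
    sideDifference-sparse g = length≤2 (Unique.filter⁺ uses? edges-unique)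
      (λ f∈ → isInj₁ᵇ (corners f∈)) (λ f∈ f′∈ → same (corners f∈) (corners f′∈))
      where
      uses? = λ f → ¬? (sideDifference f g ≟ 0ℚ)
      corners : ∀ {f} → f ∈ filter uses? (edges G) →
        Corner g f (lo g) (hi g) ⊎ Corner g f (hi g) (lo g)
      corners f∈ = sideDifference≢0 (proj₂ (∈-filter⁻ uses? {xs = edges G} f∈))
      isInj₁ᵇ : ∀ {P Q : Set} → P ⊎ Q → Bool
      isInj₁ᵇ (inj₁ _) = true
      isInj₁ᵇ (inj₂ _) = false
      same : ∀ {f f′} (s : Corner g f (lo g) (hi g) ⊎ Corner g f (hi g) (lo g))
        (s′ : Corner g f′ (lo g) (hi g) ⊎ Corner g f′ (hi g) (lo g)) →
        isInj₁ᵇ s ≡ isInj₁ᵇ s′ → f ≡ f′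
      same (inj₁ c) (inj₁ c′) _ = corner-unique c c′
      same (inj₂ c) (inj₂ c′) _ = corner-unique c c′

    open Polynomial (_≟ᴱ_ {G = G})
    open Forms (edges G) edges-unique edges-complete sumDifference

    -- Positivity of the apolar product yields a word with nonzero derivatives of both products. The
    -- one for `sumDifference` gives the coefficient, the one for `sideDifference` bounds the
    -- exponents.
    nonvanishing-coefficient :
      ∃[ K ] ((∀ e → K e ℕ.≤ 2) × degree K (edges G) ≡ length (edges G) × coef (edges G) K ≢ 0ℚ)
    nonvanishing-coefficient =
      let es = edges G
          k = length es
          positive-product = subst (0ℚ <_)
            (polarProduct-cong V es difference difference sumDifference sideDifference
              pairing k es es)
            (0<polarProduct V difference (fromℕ ∘ toℕ) 0<difference-toℕ es)
          w , w∈ , ≢0 = ∑≢0⇒∃≢0 (words es k) _ (0<p⇒p≢0 positive-product)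
          K = multiplicity w
      in K
       , (λ g → ℕ.≤-trans (multiplicity-≤ _≟ᴱ_ sideDifference es w
                  (p*q≢0⇒q≢0 (polar sumDifference es w) _ ≢0) g) (sideDifference-sparse g))
       , trans (degree-multiplicity w) (∈-words⁻ es k w∈)
       , p*q≢0⇒q≢0 (multiplicityFactorials w) _
           (λ eq → p*q≢0⇒p≢0 _ (polar sideDifference es w) ≢0 (trans (polar≡coef es w) eq))

-- From the lists to a proper weighting.

≈ℝ-refl : ∀ x → x ≈ℝ x
≈ℝ-refl x ε 0<ε = 0 , λ k _ → subst (_< ε) (sym (cong ∣_∣ (+-inverseʳ (seq x k)))) 0<ε

cauchy-seq : ∀ x → Cauchy (seq x)
cauchy-seq x = mkCauchy (cauchy x)

#⇒nonVanishing : ∀ {x y} → x # y → NonVanishing (λ k → seq x k - seq y k)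
#⇒nonVanishing (ε , 0<ε , N , p) = nonVanishing ε 0<ε N p

nonVanishing⇒# : ∀ {x y} → NonVanishing (λ k → seq x k - seq y k) → x # y
nonVanishing⇒# (nonVanishing ε 0<ε N p) = ε , 0<ε , N , p

theorem1p1 : (n : ℕ) (G : SimpleGraph n) →
    OddCliqueDecomposition G → TotalWeightChoosable G 1 3
theorem1p1 n G D LV LE =
  φ , proper , (λ v → zero , ≈ℝ-refl (φ (inj₁ v))) , (λ e → c e , ≈ℝ-refl (φ (inj₂ e)))
  where
  p : ℕ → Edge G → Fin 3 → ℚ
  p k e i = seq (elem (LE e) i) k

  -- The vertex lists are singletons, so the vertex weights are forced and enter as constants.
  γ : ℕ → Edge G → ℚ
  γ k e = seq (elem (LV (hi e)) zero) k - seq (elem (LV (lo e)) zero) k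

  cauchy-γ : ∀ e → Cauchy (λ k → γ k e)
  cauchy-γ e = cauchy-sub (cauchy-seq (elem (LV (hi e)) zero)) (cauchy-seq (elem (LV (lo e)) zero))

  coefficient = nonvanishing-coefficient G D

  choice = combinatorialNullstellensatz _≟ᴱ_ (edges G) edges-unique edges-complete (sumDifference G)
    p (λ e i → cauchy-seq (elem (LE e) i))
    (λ e i j i≢j → #⇒nonVanishing {elem (LE e) i} {elem (LE e) j} (distinct (LE e) i j i≢j))
    γ cauchy-γ (edges G) (proj₁ coefficient) (proj₁ (proj₂ coefficient))
    (ℕ.≤-reflexive (sym (proj₁ (proj₂ (proj₂ coefficient)))))
    (proj₂ (proj₂ (proj₂ coefficient)))

  c : Edge G → Fin 3
  c = proj₁ choice

  φ : TotalWeighting G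
  φ (inj₁ v) = elem (LV v) zero
  φ (inj₂ e) = elem (LE e) (c e)

  proper : Proper G φ
  proper e = nonVanishing⇒# {vertexSum G φ (lo e)} {vertexSum G φ (hi e)}
    -- The forms are upper end minus lower end, while `Proper` compares the lower end with the upper
    -- one.
    (nonVanishing-sub-comm {seq (vertexSum G φ (hi e))} {seq (vertexSum G φ (lo e))}
      (nonVanishing-cong (seq-vertexSum-difference G φ e) (proj₂ choice (edges-complete e))))
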